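{- Let $q=p^h$ ($p$ prime, $h\ge1$), $n\geq 2$, $1\le k\le n-1$. Let $c\in C_k(n,q)$ have weight smaller than $2q^k$, and suppose $(c,S)\neq 0$ for some $(n-k)$-dimensional subspace $S$ of $PG(n,q)$. Then $supp(c)$ is a minimal $k$-blocking set of $PG(n,q)$; moreover there is $a\in\mathbb{F}_p^\ast$ such that every coordinate of $c$ lies in $\{0,a\}$, and $supp(c)$ meets every $(n-k)$-dimensional subspace in $1\pmod p$ points.
   Context: $C_k(n,q)$ is the $p$-ary linear code spanned over $\mathbb{F}_p$ by the rows of the incidence matrix whose rows are indexed by the $k$-dimensional subspaces of $PG(n,q)$ and columns by the points, with entry $1$ if the point lies in the subspace and $0$ otherwise; codewords are vectors indexed by points. $c_P$ denotes the coordinate of $c$ at point $P$, $supp(c)$ is the set of points $P$ with $c_P\ne0$, the weight is $|supp(c)|$, and for a subspace $S$, $(c,S)=\sum_{P\in S}c_P\in\mathbb{F}_p$ (scalar product with the incidence vector of $S$). A $k$-blocking set is a point set meeting every $(n-k)$-dimensional subspace; it is minimal if no proper subset is a $k$-blocking set. -}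

module Defs where

open import Level using (0ℓ)
open import Data.Nat using (ℕ; zero; suc; _+_; _*_; _%_; NonZero)
open import Data.Bool using (Bool; true; false; if_then_else_)
open import Data.Product using (Σ; ∃; _×_; _,_; proj₁; proj₂)
open import Data.List using (List; []; _∷_; map; length; filterᵇ; concatMap)
open import Data.List.Membership.Propositional using (_∈_)
open import Data.List.Relation.Unary.Unique.Propositional using (Unique)
open import Data.List.Relation.Unary.Any using (Any; any?)
open import Data.Nat.ListAction using (sum)
open import Data.Vec using (Vec; []; _∷_; replicate; zipWith; foldr)
open import Data.Vec.Properties using (≡-dec)
open import Relation.Binary.PropositionalEquality using (_≡_; _≢_)
open import Relation.Binary.Definitions using (DecidableEquality)
open import Relation.Nullary using (Dec; ¬_; ⌊_⌋)
open import Algebra.Structures using (IsCommutativeRing)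

record FiniteField : Set₁ where
  infixl 7 _*F_
  infixl 6 _+F_
  field
    Carrier     : Set
    _+F_ _*F_   : Carrier → Carrier → Carrier
    -F_         : Carrier → Carrier
    0F 1F       : Carrier
    isCommRing  : IsCommutativeRing _≡_ _+F_ _*F_ -F_ 0F 1F
    0≢1         : 0F ≢ 1F
    inverse     : ∀ x → x ≢ 0F → Σ Carrier λ y → x *F y ≡ 1F
    _≟F_        : DecidableEquality Carrier
    elements    : List Carrier
    complete    : ∀ x → x ∈ elements
    distinct    : Unique elements

  order : ℕ
  order = length elements

open FiniteField public

module _ (F : FiniteField) where
  private
    K = Carrier F

  allVecs : (m : ℕ) → List (Vec K m)
  allVecs zero    = [] ∷ []
  allVecs (suc m) = concatMap (λ x → map (x ∷_) (allVecs m)) (elements F)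

  zeroVec : (m : ℕ) → Vec K m
  zeroVec m = replicate m (0F F)

  scale : {m : ℕ} → K → Vec K m → Vec K m
  scale a = Data.Vec.map (_*F_ F a)

  addVec : {m : ℕ} → Vec K m → Vec K m → Vec K m
  addVec = zipWith (_+F_ F)

  lincomb : {m d : ℕ} → Vec K d → Vec (Vec K m) d → Vec K m
  lincomb {m} []       []       = zeroVec m
  lincomb     (a ∷ as) (b ∷ bs) = addVec (scale a b) (lincomb as bs)

  -- Projective points of PG(n,q) are represented by their normalised
  -- homogeneous coordinate vector in F^(n+1): nonzero, and the first
  -- nonzero coordinate equals 1.
  isNormalised : {m : ℕ} → Vec K m → Bool
  isNormalised []       = false
  isNormalised (x ∷ xs) =
    if ⌊ _≟F_ F x (0F F) ⌋ then isNormalised xs else ⌊ _≟F_ F x (1F F) ⌋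

  IsPoint : (n : ℕ) → Vec K (suc n) → Set
  IsPoint n v = isNormalised v ≡ true

  points : (n : ℕ) → List (Vec K (suc n))
  points n = filterᵇ isNormalised (allVecs (suc n))

  -- A d-dimensional (projective) subspace of PG(n,q): a (d+1)-dimensional
  -- vector subspace of F^(n+1), given by a linearly independent basis.
  LinIndep : {m d : ℕ} → Vec (Vec K m) d → Set
  LinIndep {m} {d} B = ∀ (λs : Vec K d) → lincomb λs B ≡ zeroVec m → λs ≡ replicate d (0F F)

  Subspace : (n d : ℕ) → Set
  Subspace n d = Σ (Vec (Vec K (suc n)) (suc d)) LinIndep

  _∈S_ : {n d : ℕ} → Vec K (suc n) → Subspace n d → Set
  _∈S_ {n} {d} P (B , _) = Any (λ λs → lincomb λs B ≡ P) (allVecs (suc d))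

  _∈S?_ : {n d : ℕ} → (P : Vec K (suc n)) → (S : Subspace n d) → Dec (P ∈S S)
  _∈S?_ {n} {d} P (B , _) = any? (λ λs → ≡-dec (_≟F_ F) (lincomb λs B) P) (allVecs (suc d))

  -- Codewords: functions on points with values in F_p, where F_p is
  -- represented by ℕ-representatives in {0,…,p-1}.

  Word : ℕ → Set
  Word n = Vec K (suc n) → ℕ

  incidence : {n d : ℕ} → Subspace n d → Word n
  incidence S P = if ⌊ P ∈S? S ⌋ then 1 else 0

  InCode : (p : ℕ) .{{_ : NonZero p}} (k n : ℕ) → Word n → Set
  InCode p k n c =
    ∃ λ (gens : List (Subspace n k × ℕ)) →
      ∀ P → IsPoint n P →
        c P ≡ sum (map (λ g → proj₂ g * incidence (proj₁ g) P) gens) % p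

  weight : {n : ℕ} → Word n → ℕ
  weight {n} c = length (filterᵇ (λ P → ⌊ ¬? (c P Data.Nat.≟ 0) ⌋) (points n))
    where open import Relation.Nullary using (¬?)

  scalar : (p : ℕ) .{{_ : NonZero p}} {n d : ℕ} → Word n → Subspace n d → ℕ
  scalar p {n} c S = sum (map c (filterᵇ (λ P → ⌊ P ∈S? S ⌋) (points n))) % p

  supp : {n : ℕ} → Word n → Vec K (suc n) → Set
  supp {n} c P = IsPoint n P × c P ≢ 0

  PointSet : ℕ → Set₁
  PointSet n = Vec K (suc n) → Set

  IsBlocking : (n k : ℕ) → PointSet n → Set
  IsBlocking n k B =
    (∀ P → B P → IsPoint n P) ×
    (∀ (S : Subspace n (n Data.Nat.∸ k)) → ∃ λ P → B P × P ∈S S)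

  IsMinimalBlocking : (n k : ℕ) → PointSet n → Set₁
  IsMinimalBlocking n k B =
    IsBlocking n k B ×
    (∀ (B' : PointSet n) → (∀ P → B' P → B P) → IsBlocking n k B' → ∀ P → B P → B' P)

  suppMeet : {n d : ℕ} → Word n → Subspace n d → ℕ
  suppMeet {n} c S =
    length (filterᵇ (λ P → ⌊ P ∈S? S ⌋ Data.Bool.∧ ⌊ ¬? (c P Data.Nat.≟ 0) ⌋) (points n))
    where open import Relation.Nullary using (¬?)

{-# OPTIONS --safe #-}

-- Let B = supp c. A k-space and an (n−k)-space meet in a nonzero subspace, which has 1 mod p points; hence
-- (c,S) is the same value α ≠ 0 for all (n−k)-spaces S. It suffices to find, for each R ∈ B, an (n−k)-space
-- tangent to B at R: then c_R = α, B is minimal, and α |S ∩ B| = α in F_p.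
--
-- Projecting from R and then successively from points chosen by averaging yields an (n−k)-space S₀ ∋ R which
-- contains at most one further point of B. Suppose it contains one, Q. Then c_R + c_Q = α with both terms
-- nonzero. Split F^(n+1) as S₀ ⊕ F^k and consider the graphs of the maps x ↦ ξ(x) u + η(x) v from S₀ to
-- W = F^k, where ξ, η are linear forms on S₀ with ξ(R) = 1, η(R) = 0, η(Q) ≠ 0. For (u,v) ≠ (0,0) the graph
-- does not contain both R and Q, so it contains a point (x,e) of B outside S₀, that is, ξ(x) u + η(x) v = e.
-- Identify W with the polynomials of degree < k in F[t], an integral domain. The product of the
-- |B| − 2 ≤ 2 q^k − 3 factors ξ(x) u + η(x) v − e then vanishes on W × W except at the origin. As in Jamison's
-- theorem, this needs degree at least 2 (|W| − 1) = 2 q^k − 2, a contradiction.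
module Submission where

open import Defs
open import Level using (0ℓ)
open import Algebra.Bundles using (CommutativeRing)
open import Data.Bool using (Bool; true; false; if_then_else_; _∧_; T?)
open import Data.Bool.Properties using (T-≡)
open import Data.Empty using (⊥; ⊥-elim)
open import Data.Fin using (Fin; zero; suc)
open import Data.List
  using (List; []; _∷_; map; length; filterᵇ; concatMap; _++_; cartesianProduct; cartesianProductWith)
import Data.List.Properties as List
open import Data.List.Membership.Propositional using (_∈_; lose; find)
open import Data.List.Membership.Propositional.Properties
  using (∈-∃++; ∈-map⁺; ∈-cartesianProductWith⁺; ∈-filter⁺; ∈-filter⁻)
open import Data.List.Relation.Binary.Permutation.Propositional using (_↭_; ↭-sym; ↭-trans; ↭-prep; ↭⇒↭ₛ)
open import Data.List.Relation.Binary.Permutation.Propositional.Properties using (shift; ∈-resp-↭; ↭-length)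
import Data.List.Relation.Binary.Permutation.Propositional.Properties as Perm
import Data.List.Relation.Binary.Permutation.Setoid.Properties as Permₛ
open import Data.List.Relation.Unary.All as All using (All; []; _∷_)
import Data.List.Relation.Unary.All.Properties as All
open import Data.List.Relation.Unary.AllPairs using ([]; _∷_)
open import Data.List.Relation.Unary.Any using (Any; here; there; any?)
import Data.List.Relation.Unary.Any.Properties as Any
open import Data.List.Relation.Unary.Unique.Propositional using (Unique)
import Data.List.Relation.Unary.Unique.Propositional.Properties as Unique
open import Data.Nat
  using (ℕ; zero; suc; 2+; pred; _∸_; _+_; _*_; _^_; _%_; _≤_; _<_; z≤n; s≤s; z<s; NonZero; >-nonZero; nonTrivial⇒n>1)
open import Data.Nat.DivMod using (%-distribˡ-+; %-distribˡ-*; m%n%n≡m%n; m<n⇒m%n≡m; m%n<n)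
open import Data.Nat.Divisibility using (_∣_; _∣0; n∣m⇒m%n≡0; m%n≡0⇒n∣m; ∣m⇒∣m*n; m∣m*n)
open import Data.Nat.ListAction using (sum)
open import Data.Nat.ListAction.Properties using (sum-++; sum-↭)
open import Data.Nat.Primality using (Prime; euclidsLemma; prime⇒nonTrivial)
import Data.Nat.Properties as ℕ
open import Data.Nat.Solver using (module +-*-Solver)
open import Data.Product using (_×_; ∃; Σ; _,_; proj₁; proj₂)
open import Data.Sum using (_⊎_; inj₁; inj₂; map₂)
open import Data.Vec using (Vec; []; _∷_; lookup; head; tail)
import Data.Vec.Properties as Vec
open import Function using (_∘_; id)
open import Function.Bundles using (Equivalence)
open import Relation.Binary.PropositionalEquality
open import Relation.Nullary using (Dec; yes; no; ¬_; ⌊_⌋; ¬?; contradiction)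
open import Relation.Nullary.Decidable using (_×-dec_)

private
  variable
    A B : Set
    P Q : Set

-- Finite sums

∑ : List A → (A → ℕ) → ℕ
∑ xs f = sum (map f xs)

-- Unfolds to the same conditional as `incidence`, so membership indicators and incidence values
-- agree by definition.
[_]? : Dec P → ℕ
[ d ]? = if ⌊ d ⌋ then 1 else 0

[]?-cong : (d : Dec P) (e : Dec Q) → (P → Q) → (Q → P) → [ d ]? ≡ [ e ]?
[]?-cong (yes _) (yes _) _ _ = refl
[]?-cong (yes p) (no ¬q) f _ = contradiction (f p) ¬q
[]?-cong (no ¬p) (yes q) _ g = contradiction (g q) ¬p
[]?-cong (no _)  (no _)  _ _ = refl

[]?-yes : (d : Dec P) → P → [ d ]? ≡ 1
[]?-yes (yes _) _ = refl
[]?-yes (no ¬p) p = contradiction p ¬p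

[]?-no : (d : Dec P) → ¬ P → [ d ]? ≡ 0
[]?-no (yes p) ¬p = contradiction p ¬p
[]?-no (no _) _ = refl

[]?≡0⇒¬ : (d : Dec P) → [ d ]? ≡ 0 → ¬ P
[]?≡0⇒¬ d eq h with () ← trans (sym eq) ([]?-yes d h)

[]?-× : (d : Dec P) (e : Dec Q) → [ d ]? * [ e ]? ≡ [ d ×-dec e ]?
[]?-× (yes _) (yes _) = refl
[]?-× (yes _) (no _)  = refl
[]?-× (no _)  e       = refl

∑-cong : (xs : List A) {f g : A → ℕ} → (∀ x → f x ≡ g x) → ∑ xs f ≡ ∑ xs g
∑-cong xs eq = cong sum (List.map-cong eq xs)

∑-cong-∈ : (xs : List A) {f g : A → ℕ} → (∀ x → x ∈ xs → f x ≡ g x) → ∑ xs f ≡ ∑ xs g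
∑-cong-∈ []       _ = refl
∑-cong-∈ (x ∷ xs) h = cong₂ _+_ (h x (here refl)) (∑-cong-∈ xs (λ y → h y ∘ there))

∑-+ : (xs : List A) (f g : A → ℕ) → ∑ xs (λ x → f x + g x) ≡ ∑ xs f + ∑ xs g
∑-+ []       f g = refl
∑-+ (x ∷ xs) f g rewrite ∑-+ xs f g =
  solve 4 (λ a b c d → a :+ b :+ (c :+ d) := a :+ c :+ (b :+ d)) refl (f x) (g x) (∑ xs f) (∑ xs g)
  where open +-*-Solver

∑-const : (xs : List A) (a : ℕ) → ∑ xs (λ _ → a) ≡ length xs * a
∑-const []       a = refl
∑-const (x ∷ xs) a = cong (a +_) (∑-const xs a)

∑-zero : (xs : List A) → ∑ xs (λ _ → 0) ≡ 0
∑-zero xs = trans (∑-const xs 0) (ℕ.*-zeroʳ (length xs))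

∑-*ˡ : (xs : List A) (a : ℕ) (f : A → ℕ) → ∑ xs (λ x → a * f x) ≡ a * ∑ xs f
∑-*ˡ []       a f = sym (ℕ.*-zeroʳ a)
∑-*ˡ (x ∷ xs) a f = trans (cong (a * f x +_) (∑-*ˡ xs a f)) (sym (ℕ.*-distribˡ-+ a (f x) _))

∑-swap : (xs : List A) (ys : List B) (f : A → B → ℕ) →
  ∑ xs (λ x → ∑ ys (f x)) ≡ ∑ ys (λ y → ∑ xs (λ x → f x y))
∑-swap []       ys f = sym (∑-zero ys)
∑-swap (x ∷ xs) ys f = trans (cong (∑ ys (f x) +_) (∑-swap xs ys f)) (sym (∑-+ ys (f x) _))

∑-concatMap : (xs : List A) (h : A → List B) (f : B → ℕ) →
  ∑ (concatMap h xs) f ≡ ∑ xs (λ x → ∑ (h x) f)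
∑-concatMap []       h f = refl
∑-concatMap (x ∷ xs) h f = begin
  sum (map f (h x ++ concatMap h xs))           ≡⟨ cong sum (List.map-++ f (h x) _) ⟩
  sum (map f (h x) ++ map f (concatMap h xs))   ≡⟨ sum-++ (map f (h x)) _ ⟩
  ∑ (h x) f + ∑ (concatMap h xs) f              ≡⟨ cong (∑ (h x) f +_) (∑-concatMap xs h f) ⟩
  ∑ (h x) f + ∑ xs (λ x → ∑ (h x) f)            ∎
  where open ≡-Reasoning

∑-map : (g : A → B) (xs : List A) (f : B → ℕ) → ∑ (map g xs) f ≡ ∑ xs (f ∘ g)
∑-map g xs f = cong sum (sym (List.map-∘ xs))

∑-filterᵇ : (b : A → Bool) (xs : List A) (f : A → ℕ) →
  ∑ (filterᵇ b xs) f ≡ ∑ xs (λ x → (if b x then 1 else 0) * f x)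
∑-filterᵇ b []       f = refl
∑-filterᵇ b (x ∷ xs) f with b x
... | true  = cong₂ _+_ (sym (ℕ.*-identityˡ (f x))) (∑-filterᵇ b xs f)
... | false = ∑-filterᵇ b xs f

length-∑ : (xs : List A) → length xs ≡ ∑ xs (λ _ → 1)
length-∑ xs = trans (sym (ℕ.*-identityʳ _)) (sym (∑-const xs 1))

∑-≤-length : (xs : List A) {f : A → ℕ} → (∀ x → x ∈ xs → f x ≤ 1) → ∑ xs f ≤ length xs
∑-≤-length []       _ = z≤n
∑-≤-length (x ∷ xs) h = ℕ.+-mono-≤ (h x (here refl)) (∑-≤-length xs (λ y → h y ∘ there))

∑-≡0 : (xs : List A) {f : A → ℕ} → (∀ x → x ∈ xs → f x ≡ 0) → ∑ xs f ≡ 0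
∑-≡0 []       _ = refl
∑-≡0 (x ∷ xs) h = cong₂ _+_ (h x (here refl)) (∑-≡0 xs (λ y → h y ∘ there))

∑-≡0⁻ : (xs : List A) {f : A → ℕ} → ∑ xs f ≡ 0 → ∀ x → x ∈ xs → f x ≡ 0
∑-≡0⁻ (x ∷ xs) {f} eq .x (here refl) = ℕ.m+n≡0⇒m≡0 (f x) eq
∑-≡0⁻ (x ∷ xs) {f} eq y (there y∈) = ∑-≡0⁻ xs (ℕ.m+n≡0⇒n≡0 (f x) eq) y y∈

-- Averaging: were all values at least `t`, the sum would be at least `length xs * t`.
∑-<⇒∃ : (t : ℕ) (xs : List A) (f : A → ℕ) → ∑ xs f < length xs * t → ∃ λ x → f x < t
∑-<⇒∃ t (x ∷ xs) f lt with f x ℕ.<? t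
... | yes fx<t = x , fx<t
... | no  fx≮t = ∑-<⇒∃ t xs f (ℕ.+-cancelˡ-< t _ _
      (ℕ.≤-<-trans (ℕ.+-monoˡ-≤ (∑ xs f) (ℕ.≮⇒≥ fx≮t)) lt))

∑-atMostOne : {R : A → Set} (R? : ∀ x → Dec (R x)) {xs : List A} → Unique xs →
  (∀ x y → R x → R y → x ≡ y) → ∑ xs (λ x → [ R? x ]?) ≤ 1
∑-atMostOne R? {[]}     _         _ = z≤n
∑-atMostOne R? {x ∷ xs} (x∉ ∷ u) one with R? x
... | no  _ = ∑-atMostOne R? u one
... | yes r = s≤s (ℕ.≤-reflexive (∑-≡0 xs λ y y∈ → []?-no (R? y) λ ry → All.lookup x∉ y∈ (one x y r ry)))

∈⇒↭ : {x : A} {xs : List A} → x ∈ xs → ∃ λ ys → xs ↭ x ∷ ys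
∈⇒↭ x∈ with as , bs , refl ← ∈-∃++ x∈ = as ++ bs , shift _ as bs

∑-↭ : {xs ys : List A} (f : A → ℕ) → xs ↭ ys → ∑ xs f ≡ ∑ ys f
∑-↭ f p = sum-↭ (Perm.map⁺ f p)

-- An entry of `xs` is split off from `ys` by a permutation; as `xs` has no repetitions, its other
-- entries survive in the remainder.
∑-⊆ : {xs ys : List A} (f : A → ℕ) → Unique xs → (∀ x → x ∈ xs → x ∈ ys) → ∑ xs f ≤ ∑ ys f
∑-⊆ {xs = []}     f _ _ = z≤n
∑-⊆ {xs = x ∷ xs} {ys} f (x∉ ∷ u) sub with zs , p ← ∈⇒↭ (sub x (here refl)) =
  subst (∑ (x ∷ xs) f ≤_) (sym (∑-↭ f p)) (ℕ.+-monoʳ-≤ (f x) (∑-⊆ f u sub′))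
  where
  sub′ : ∀ y → y ∈ xs → y ∈ zs
  sub′ y y∈ with ∈-resp-↭ p (sub y (there y∈))
  ... | here refl = contradiction refl (All.lookup x∉ y∈)
  ... | there y∈zs = y∈zs

length-⊆ : {xs ys : List A} → Unique xs → (∀ x → x ∈ xs → x ∈ ys) → length xs ≤ length ys
length-⊆ {xs = xs} {ys} u sub =
  subst₂ _≤_ (sym (length-∑ xs)) (sym (length-∑ ys)) (∑-⊆ (λ _ → 1) u sub)

∑-bijection : {xs : List A} → Unique xs → (∀ x → x ∈ xs) → (φ ψ : A → A) →
  (∀ x → ψ (φ x) ≡ x) → (∀ x → φ (ψ x) ≡ x) → (f : A → ℕ) → ∑ xs (f ∘ φ) ≡ ∑ xs f
∑-bijection {xs = xs} u all φ ψ ψφ φψ f = trans (sym (∑-map φ xs f)) (ℕ.≤-antisym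
  (∑-⊆ f (Unique.map⁺ φ-injective u) (λ x _ → all x))
  (∑-⊆ f u (λ x _ → subst (_∈ map φ xs) (φψ x) (∈-map⁺ φ (all (ψ x))))))
  where
  φ-injective : ∀ {x y} → φ x ≡ φ y → x ≡ y
  φ-injective {x} {y} eq = trans (sym (ψφ x)) (trans (cong ψ eq) (ψφ y))

length-cartesianProduct : (xs : List A) (ys : List B) →
  length (cartesianProduct xs ys) ≡ length xs * length ys
length-cartesianProduct []       ys = refl
length-cartesianProduct (x ∷ xs) ys = trans (List.length-++ (map (x ,_) ys))
  (cong₂ _+_ (List.length-map (x ,_) ys) (length-cartesianProduct xs ys))

∈-filterᵇ⁺ : (b : A → Bool) {x : A} {xs : List A} → x ∈ xs → b x ≡ true → x ∈ filterᵇ b xs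
∈-filterᵇ⁺ b x∈ eq = ∈-filter⁺ (T? ∘ b) x∈ (Equivalence.from T-≡ eq)

∈-filterᵇ⁻ : (b : A → Bool) {x : A} {xs : List A} → x ∈ filterᵇ b xs → x ∈ xs × b x ≡ true
∈-filterᵇ⁻ b x∈ with x∈xs , t ← ∈-filter⁻ (T? ∘ b) x∈ = x∈xs , Equivalence.to T-≡ t

length-filterᵇ : (b : A → Bool) (xs : List A) → length (filterᵇ b xs) ≡ ∑ xs (λ x → if b x then 1 else 0)
length-filterᵇ b xs = trans (length-∑ (filterᵇ b xs))
  (trans (∑-filterᵇ b xs _) (∑-cong xs λ x → ℕ.*-identityʳ _))

-- Congruences

module Congruence (p : ℕ) .{{_ : NonZero p}} where

  infix 4 _≈_
  _≈_ : ℕ → ℕ → Set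
  a ≈ b = a % p ≡ b % p

  +-≈ : ∀ {a b c d} → a ≈ b → c ≈ d → a + c ≈ b + d
  +-≈ {a} {b} {c} {d} h h′ = trans (%-distribˡ-+ a c p)
    (trans (cong₂ (λ x y → (x + y) % p) h h′) (sym (%-distribˡ-+ b d p)))

  *-≈ : ∀ {a b c d} → a ≈ b → c ≈ d → a * c ≈ b * d
  *-≈ {a} {b} {c} {d} h h′ = trans (%-distribˡ-* a c p)
    (trans (cong₂ (λ x y → (x * y) % p) h h′) (sym (%-distribˡ-* b d p)))

  %-≈ : ∀ a → a % p ≈ a
  %-≈ a = m%n%n≡m%n a p

  ∣⇒≈0 : ∀ {a} → p ∣ a → a ≈ 0
  ∣⇒≈0 {a} d = trans (n∣m⇒m%n≡0 a p d) (sym (n∣m⇒m%n≡0 0 p (p ∣0)))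

  ≈0⇒∣ : ∀ {a} → a ≈ 0 → p ∣ a
  ≈0⇒∣ {a} h = m%n≡0⇒n∣m a p (trans h (n∣m⇒m%n≡0 0 p (p ∣0)))

  ≈⇒≡ : ∀ {a b} → a < p → b < p → a ≈ b → a ≡ b
  ≈⇒≡ a<p b<p h = trans (sym (m<n⇒m%n≡m a<p)) (trans h (m<n⇒m%n≡m b<p))

  -- (p ∸ 1) a serves as the negative of a.
  +-≈-cancelˡ : ∀ a {b c} → a + b ≈ a + c → b ≈ c
  +-≈-cancelˡ a {b} {c} h = begin
    b % p                            ≡⟨ lemma b ⟨
    (pred p * a + (a + b)) % p       ≡⟨ +-≈ {pred p * a} refl h ⟩
    (pred p * a + (a + c)) % p       ≡⟨ lemma c ⟩
    c % p                            ∎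
    where
    open ≡-Reasoning
    lemma : ∀ b → pred p * a + (a + b) ≈ b
    lemma b = begin
      (pred p * a + (a + b)) % p   ≡⟨ cong (_% p) (sym (ℕ.+-assoc (pred p * a) a b)) ⟩
      (pred p * a + a + b) % p     ≡⟨ cong (λ x → (x + b) % p) (ℕ.+-comm (pred p * a) a) ⟩
      (suc (pred p) * a + b) % p   ≡⟨ cong (λ x → (x * a + b) % p) (ℕ.suc-pred p) ⟩
      (p * a + b) % p              ≡⟨ +-≈ {p * a} {0} {b} (∣⇒≈0 (m∣m*n a)) refl ⟩
      b % p                        ∎

  ∑-≈ : (xs : List A) {f g : A → ℕ} → (∀ x → f x ≈ g x) → ∑ xs f ≈ ∑ xs g
  ∑-≈ []       h = refl
  ∑-≈ (x ∷ xs) h = +-≈ (h x) (∑-≈ xs h)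

-- Vectors over F and point counts of subspaces

module LinearAlgebra (F : FiniteField) where

  K = Carrier F
  q = order F

  ring : CommutativeRing 0ℓ 0ℓ
  ring = record { isCommutativeRing = isCommRing F }

  open CommutativeRing ring public using ()
    renaming ( _+_ to _+ᵏ_; _*_ to _*ᵏ_; -_ to -ᵏ_; 0# to 0ᵏ; 1# to 1ᵏ
             ; +-assoc to +ᵏ-assoc; +-comm to +ᵏ-comm
             ; +-identityˡ to +ᵏ-identityˡ; +-identityʳ to +ᵏ-identityʳ
             ; -‿inverseʳ to -ᵏ-inverseʳ
             ; *-assoc to *ᵏ-assoc; *-comm to *ᵏ-comm
             ; *-identityˡ to *ᵏ-identityˡ; *-identityʳ to *ᵏ-identityʳ
             ; distribˡ to *ᵏ-distribˡ; distribʳ to *ᵏ-distribʳ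
             ; zeroˡ to *ᵏ-zeroˡ; zeroʳ to *ᵏ-zeroʳ )

  infix 4 _≟ᵏ_ _≟ᵛ_
  infixl 6 _⊕_
  infixr 7 _·_

  V : ℕ → Set
  V = Vec K

  0ᵛ : ∀ {m} → V m
  0ᵛ {m} = zeroVec F m

  _⊕_ : ∀ {m} → V m → V m → V m
  _⊕_ = addVec F

  _·_ : ∀ {m} → K → V m → V m
  _·_ = scale F

  _≟ᵏ_ : (x y : K) → Dec (x ≡ y)
  _≟ᵏ_ = _≟F_ F

  _≟ᵛ_ : ∀ {m} (u v : V m) → Dec (u ≡ v)
  _≟ᵛ_ = Vec.≡-dec _≟ᵏ_

  *ᵏ-cancel-0 : ∀ {a x} → a ≢ 0ᵏ → a *ᵏ x ≡ 0ᵏ → x ≡ 0ᵏ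
  *ᵏ-cancel-0 {a} {x} a≢0 ax≡0 with b , ab≡1 ← inverse F a a≢0 = begin
    x               ≡⟨ *ᵏ-identityˡ x ⟨
    1ᵏ *ᵏ x         ≡⟨ cong (_*ᵏ x) (trans (sym ab≡1) (*ᵏ-comm a b)) ⟩
    (b *ᵏ a) *ᵏ x   ≡⟨ *ᵏ-assoc b a x ⟩
    b *ᵏ (a *ᵏ x)   ≡⟨ cong (b *ᵏ_) ax≡0 ⟩
    b *ᵏ 0ᵏ         ≡⟨ *ᵏ-zeroʳ b ⟩
    0ᵏ              ∎
    where open ≡-Reasoning

  -ᵏ-nonzero : ∀ {a} → a ≢ 0ᵏ → -ᵏ a ≢ 0ᵏ
  -ᵏ-nonzero {a} a≢0 -a≡0 = a≢0 (begin
    a             ≡⟨ +ᵏ-identityʳ a ⟨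
    a +ᵏ 0ᵏ       ≡⟨ cong (a +ᵏ_) -a≡0 ⟨
    a +ᵏ (-ᵏ a)   ≡⟨ -ᵏ-inverseʳ a ⟩
    0ᵏ            ∎)
    where open ≡-Reasoning

  ⊕-assoc : ∀ {m} (u v w : V m) → (u ⊕ v) ⊕ w ≡ u ⊕ (v ⊕ w)
  ⊕-assoc = Vec.zipWith-assoc +ᵏ-assoc

  ⊕-comm : ∀ {m} (u v : V m) → u ⊕ v ≡ v ⊕ u
  ⊕-comm = Vec.zipWith-comm +ᵏ-comm

  ⊕-identityˡ : ∀ {m} (v : V m) → 0ᵛ ⊕ v ≡ v
  ⊕-identityˡ = Vec.zipWith-identityˡ +ᵏ-identityˡ

  ⊕-identityʳ : ∀ {m} (v : V m) → v ⊕ 0ᵛ ≡ v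
  ⊕-identityʳ = Vec.zipWith-identityʳ +ᵏ-identityʳ

  ·-distrib-⊕ : ∀ {m} a (u v : V m) → a · (u ⊕ v) ≡ a · u ⊕ a · v
  ·-distrib-⊕ a []      []      = refl
  ·-distrib-⊕ a (x ∷ u) (y ∷ v) = cong₂ _∷_ (*ᵏ-distribˡ a x y) (·-distrib-⊕ a u v)

  ·-distrib-+ᵏ : ∀ {m} a b (v : V m) → (a +ᵏ b) · v ≡ a · v ⊕ b · v
  ·-distrib-+ᵏ a b []      = refl
  ·-distrib-+ᵏ a b (x ∷ v) = cong₂ _∷_ (*ᵏ-distribʳ x a b) (·-distrib-+ᵏ a b v)

  ·-assoc : ∀ {m} a b (v : V m) → (a *ᵏ b) · v ≡ a · (b · v)
  ·-assoc a b []      = refl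
  ·-assoc a b (x ∷ v) = cong₂ _∷_ (*ᵏ-assoc a b x) (·-assoc a b v)

  ·-identityˡ : ∀ {m} (v : V m) → 1ᵏ · v ≡ v
  ·-identityˡ []      = refl
  ·-identityˡ (x ∷ v) = cong₂ _∷_ (*ᵏ-identityˡ x) (·-identityˡ v)

  ·-zeroˡ : ∀ {m} (v : V m) → 0ᵏ · v ≡ 0ᵛ
  ·-zeroˡ []      = refl
  ·-zeroˡ (x ∷ v) = cong₂ _∷_ (*ᵏ-zeroˡ x) (·-zeroˡ v)

  ·-zeroʳ : ∀ {m} a → a · 0ᵛ {m} ≡ 0ᵛ
  ·-zeroʳ {zero}  a = refl
  ·-zeroʳ {suc m} a = cong₂ _∷_ (*ᵏ-zeroʳ a) (·-zeroʳ a)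

  ·-inverseʳ : ∀ {m} a (v : V m) → a · v ⊕ (-ᵏ a) · v ≡ 0ᵛ
  ·-inverseʳ a v = trans (sym (·-distrib-+ᵏ a (-ᵏ a) v))
    (trans (cong (_· v) (-ᵏ-inverseʳ a)) (·-zeroˡ v))

  ·-inverseˡ : ∀ {m} a (v : V m) → (-ᵏ a) · v ⊕ a · v ≡ 0ᵛ
  ·-inverseˡ a v = trans (⊕-comm _ _) (·-inverseʳ a v)

  ⊖_ : ∀ {m} → V m → V m
  ⊖ v = (-ᵏ 1ᵏ) · v

  ⊖-inverseʳ : ∀ {m} (v : V m) → v ⊕ ⊖ v ≡ 0ᵛ
  ⊖-inverseʳ v = trans (cong (_⊕ ⊖ v) (sym (·-identityˡ v))) (·-inverseʳ 1ᵏ v)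

  ⊕-cancel-inverse : ∀ {m} {a b : V m} → a ⊕ b ≡ 0ᵛ → ∀ v → (v ⊕ a) ⊕ b ≡ v
  ⊕-cancel-inverse {a = a} {b} eq v =
    trans (⊕-assoc v a b) (trans (cong (v ⊕_) eq) (⊕-identityʳ v))

  ⊕-interchange : ∀ {m} (a b c d : V m) → (a ⊕ b) ⊕ (c ⊕ d) ≡ (a ⊕ c) ⊕ (b ⊕ d)
  ⊕-interchange a b c d = begin
    (a ⊕ b) ⊕ (c ⊕ d)   ≡⟨ ⊕-assoc a b (c ⊕ d) ⟩
    a ⊕ (b ⊕ (c ⊕ d))   ≡⟨ cong (a ⊕_) (⊕-assoc b c d) ⟨
    a ⊕ ((b ⊕ c) ⊕ d)   ≡⟨ cong (λ x → a ⊕ (x ⊕ d)) (⊕-comm b c) ⟩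
    a ⊕ ((c ⊕ b) ⊕ d)   ≡⟨ cong (a ⊕_) (⊕-assoc c b d) ⟩
    a ⊕ (c ⊕ (b ⊕ d))   ≡⟨ ⊕-assoc a c (b ⊕ d) ⟨
    (a ⊕ c) ⊕ (b ⊕ d)   ∎
    where open ≡-Reasoning

  ⊕⊖-zero : ∀ {m} (u v : V m) → u ⊕ ⊖ v ≡ 0ᵛ → u ≡ v
  ⊕⊖-zero u v eq = begin
    u               ≡⟨ ⊕-cancel-inverse (trans (⊕-comm _ _) (⊖-inverseʳ v)) u ⟨
    (u ⊕ ⊖ v) ⊕ v   ≡⟨ cong (_⊕ v) eq ⟩
    0ᵛ ⊕ v          ≡⟨ ⊕-identityˡ v ⟩
    v               ∎
    where open ≡-Reasoning

  ⊕-⊖-⊕ : ∀ {m} (u w : V m) → w ⊕ (u ⊕ ⊖ w) ≡ u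
  ⊕-⊖-⊕ u w = trans (⊕-comm w _) (⊕-cancel-inverse (trans (⊕-comm _ _) (⊖-inverseʳ w)) u)

  ·-cancelˡ-0 : ∀ {m a} {v : V m} → a ≢ 0ᵏ → a · v ≡ 0ᵛ → v ≡ 0ᵛ
  ·-cancelˡ-0 {v = []}    a≢0 eq = refl
  ·-cancelˡ-0 {v = x ∷ v} a≢0 eq = cong₂ _∷_
    (*ᵏ-cancel-0 a≢0 (Vec.∷-injectiveˡ eq)) (·-cancelˡ-0 a≢0 (Vec.∷-injectiveʳ eq))

  nonzero-coordinate : ∀ {m} (v : V m) → v ≢ 0ᵛ → ∃ λ i → lookup v i ≢ 0ᵏ
  nonzero-coordinate []      v≢0 = contradiction refl v≢0
  nonzero-coordinate (x ∷ v) v≢0 with x ≟ᵏ 0ᵏ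
  ... | no  x≢0  = zero , x≢0
  ... | yes refl with i , h ← nonzero-coordinate v (v≢0 ∘ cong (0ᵏ ∷_)) = suc i , h

  ∑-allVecs-suc : ∀ {m} (f : V (suc m) → ℕ) →
    ∑ (allVecs F (suc m)) f ≡ ∑ (elements F) (λ x → ∑ (allVecs F m) (λ v → f (x ∷ v)))
  ∑-allVecs-suc {m} f = trans (∑-concatMap (elements F) _ f)
    (∑-cong (elements F) λ x → ∑-map (x ∷_) (allVecs F m) f)

  length-allVecs : ∀ m → length (allVecs F m) ≡ q ^ m
  length-allVecs zero    = refl
  length-allVecs (suc m) = begin
    length (allVecs F (suc m))                       ≡⟨ length-∑ (allVecs F (suc m)) ⟩
    ∑ (allVecs F (suc m)) (λ _ → 1)                  ≡⟨ ∑-allVecs-suc (λ _ → 1) ⟩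
    ∑ (elements F) (λ _ → ∑ (allVecs F m) (λ _ → 1)) ≡⟨ ∑-const (elements F) _ ⟩
    q * ∑ (allVecs F m) (λ _ → 1)                    ≡⟨ cong (q *_) (length-∑ (allVecs F m)) ⟨
    q * length (allVecs F m)                         ≡⟨ cong (q *_) (length-allVecs m) ⟩
    q ^ suc m                                        ∎
    where open ≡-Reasoning

  allVecs-cartesianProduct : ∀ m →
    allVecs F (suc m) ≡ cartesianProductWith _∷_ (elements F) (allVecs F m)
  allVecs-cartesianProduct m = go (elements F)
    where
    go : ∀ xs → concatMap (λ x → map (x ∷_) (allVecs F m)) xs ≡ cartesianProductWith _∷_ xs (allVecs F m)
    go []       = refl
    go (x ∷ xs) = cong (map (x ∷_) (allVecs F m) ++_) (go xs)

  ∈-allVecs : ∀ {m} (v : V m) → v ∈ allVecs F m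
  ∈-allVecs []              = here refl
  ∈-allVecs {suc m} (x ∷ v) = subst ((x ∷ v) ∈_) (sym (allVecs-cartesianProduct m))
    (∈-cartesianProductWith⁺ _∷_ (complete F x) (∈-allVecs v))

  allVecs-unique : ∀ m → Unique (allVecs F m)
  allVecs-unique zero    = [] ∷ []
  allVecs-unique (suc m) = subst Unique (sym (allVecs-cartesianProduct m))
    (Unique.cartesianProductWith⁺ _∷_ Vec.∷-injective (distinct F) (allVecs-unique m))

  search : ∀ {m} {R : V m → Set} → (∀ v → Dec (R v)) → Dec (∃ R)
  search {m} R? with any? R? (allVecs F m)
  ... | yes a = yes (let v , _ , r = find a in v , r)
  ... | no ¬a = no λ (v , r) → ¬a (lose (∈-allVecs v) r)

  ∑-translate : ∀ {m} (w : V m) (f : V m → ℕ) →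
    ∑ (allVecs F m) (λ v → f (v ⊕ w)) ≡ ∑ (allVecs F m) f
  ∑-translate {m} w = ∑-bijection (allVecs-unique m) ∈-allVecs (_⊕ w) (_⊕ ⊖ w)
    (⊕-cancel-inverse (⊖-inverseʳ w))
    (⊕-cancel-inverse (trans (⊕-comm _ _) (⊖-inverseʳ w)))

  ∑-elements-≟ : ∀ a → ∑ (elements F) (λ x → [ x ≟ᵏ a ]?) ≡ 1
  ∑-elements-≟ a with es , p ← ∈⇒↭ (complete F a) = ℕ.≤-antisym
    (∑-atMostOne (_≟ᵏ a) (distinct F) (λ x y x≡a y≡a → trans x≡a (sym y≡a)))
    (subst (1 ≤_) (sym (trans (∑-↭ _ p) (cong (_+ ∑ es (λ x → [ x ≟ᵏ a ]?)) ([]?-yes (a ≟ᵏ a) refl)))) (s≤s z≤n))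

  ∑-elements-*≟ : ∀ a b → ∑ (elements F) (λ x → a * [ x ≟ᵏ b ]?) ≡ a
  ∑-elements-*≟ a b = trans (∑-*ˡ (elements F) a _) (trans (cong (a *_) (∑-elements-≟ b)) (ℕ.*-identityʳ a))

  order>1 : 1 < q
  order>1 = length-⊆ {ys = elements F} ((0≢1 F ∷ []) ∷ [] ∷ []) (λ x _ → complete F x)

  -- Linear subspaces as predicates, and their vector and point counts modulo p

  record Closed {m} (U : V m → Set) : Set where
    field
      zero∈  : U 0ᵛ
      ⊕∈     : ∀ {u v} → U u → U v → U (u ⊕ v)
      ·∈     : ∀ a {v} → U v → U (a · v)

  open Closed

  tail-closed : ∀ {m} {U : V (suc m) → Set} → Closed U → Closed (λ v → U (0ᵏ ∷ v))
  tail-closed {U = U} cl = record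
    { zero∈ = zero∈ cl
    ; ⊕∈    = λ {u} {v} hu hv → subst (λ z → U (z ∷ (u ⊕ v))) (+ᵏ-identityˡ 0ᵏ) (⊕∈ cl hu hv)
    ; ·∈    = λ a {v} h → subst (λ z → U (z ∷ a · v)) (*ᵏ-zeroʳ a) (·∈ cl a h)
    }

  ∣_∣ : ∀ {m} {U : V m → Set} → (∀ v → Dec (U v)) → ℕ
  ∣_∣ {m} U? = ∑ (allVecs F m) (λ v → [ U? v ]?)

  -- Since points are normalised vectors, this is the number of projective points of `U`.
  normalisedCount : ∀ {m} {U : V m → Set} → (∀ v → Dec (U v)) → ℕ
  normalisedCount {m} U? = ∑ (allVecs F m) (λ v → (if isNormalised F v then 1 else 0) * [ U? v ]?)

  module _ {m} {U : V (suc m) → Set} (U? : ∀ v → Dec (U v)) (cl : Closed U) where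

    fibre : K → ℕ
    fibre x = ∣ (λ v → U? (x ∷ v)) ∣

    -- Translation by `x` times the vector `1ᵏ ∷ w` of `U` carries the fibre over 0 onto the fibre
    -- over `x`.
    fibre-constant : (∃ λ w → U (1ᵏ ∷ w)) → ∀ x → fibre x ≡ fibre 0ᵏ
    fibre-constant (w , Uw) x = trans (sym (∑-translate (x · w) (λ v → [ U? (x ∷ v) ]?)))
      (∑-cong (allVecs F m) λ v → []?-cong (U? (x ∷ (v ⊕ x · w))) (U? (0ᵏ ∷ v)) (down v) (up v))
      where
      up : ∀ v → U (0ᵏ ∷ v) → U (x ∷ (v ⊕ x · w))
      up v h = subst (λ z → U (z ∷ (v ⊕ x · w)))
        (trans (+ᵏ-identityˡ _) (*ᵏ-identityʳ x)) (⊕∈ cl h (·∈ cl x Uw))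
      down : ∀ v → U (x ∷ (v ⊕ x · w)) → U (0ᵏ ∷ v)
      down v h = subst U
        (cong₂ _∷_ (trans (cong (x +ᵏ_) (*ᵏ-identityʳ (-ᵏ x))) (-ᵏ-inverseʳ x))
                   (⊕-cancel-inverse (·-inverseʳ x w) v))
        (⊕∈ cl h (·∈ cl (-ᵏ x) Uw))

    to-first-1 : ∀ {x} → x ≢ 0ᵏ → ∀ v → U (x ∷ v) → ∃ λ w → U (1ᵏ ∷ w)
    to-first-1 {x} x≢0 v h with y , xy≡1 ← inverse F x x≢0 =
      y · v , subst (λ z → U (z ∷ y · v)) (trans (*ᵏ-comm y x) xy≡1) (·∈ cl y h)

    fibre-empty : ¬ (∃ λ w → U (1ᵏ ∷ w)) → ∀ x → x ≢ 0ᵏ → fibre x ≡ 0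
    fibre-empty none x x≢0 = ∑-≡0 (allVecs F m) λ v _ → []?-no (U? (x ∷ v)) (none ∘ to-first-1 x≢0 v)

    count-suc : ∣ U? ∣ ≡ ∑ (elements F) fibre
    count-suc = ∑-allVecs-suc (λ v → [ U? v ]?)

    count-suc-full : (∃ λ w → U (1ᵏ ∷ w)) → ∣ U? ∣ ≡ q * fibre 0ᵏ
    count-suc-full h = trans count-suc
      (trans (∑-cong (elements F) (fibre-constant h)) (∑-const (elements F) _))

    count-suc-thin : ¬ (∃ λ w → U (1ᵏ ∷ w)) → ∣ U? ∣ ≡ fibre 0ᵏ
    count-suc-thin none = trans count-suc (trans (∑-cong (elements F) pointwise) (∑-elements-*≟ (fibre 0ᵏ) 0ᵏ))
      where
      pointwise : ∀ x → fibre x ≡ fibre 0ᵏ * [ x ≟ᵏ 0ᵏ ]?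
      pointwise x with x ≟ᵏ 0ᵏ
      ... | yes refl = sym (ℕ.*-identityʳ _)
      ... | no  x≢0  = trans (fibre-empty none x x≢0) (sym (ℕ.*-zeroʳ (fibre 0ᵏ)))

    -- A normalised vector starts with 0 and has a normalised tail, or starts with 1 and has an
    -- arbitrary tail.
    normalisedCount-suc : normalisedCount U? ≡ normalisedCount (λ v → U? (0ᵏ ∷ v)) + fibre 1ᵏ
    normalisedCount-suc = begin
      normalisedCount U?                                        ≡⟨ ∑-allVecs-suc {m} _ ⟩
      ∑ (elements F) f                                          ≡⟨ ∑-cong (elements F) pointwise ⟩
      ∑ (elements F) (λ x → n₀ * [ x ≟ᵏ 0ᵏ ]? + n₁ * [ x ≟ᵏ 1ᵏ ]?)  ≡⟨ ∑-+ (elements F) _ _ ⟩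
      ∑ (elements F) (λ x → n₀ * [ x ≟ᵏ 0ᵏ ]?) + ∑ (elements F) (λ x → n₁ * [ x ≟ᵏ 1ᵏ ]?)
        ≡⟨ cong₂ _+_ (∑-elements-*≟ n₀ 0ᵏ) (∑-elements-*≟ n₁ 1ᵏ) ⟩
      n₀ + n₁                                                   ∎
      where
      open ≡-Reasoning
      n₀ = normalisedCount (λ v → U? (0ᵏ ∷ v))
      n₁ = fibre 1ᵏ
      f : K → ℕ
      f x = ∑ (allVecs F m) (λ v → (if isNormalised F (x ∷ v) then 1 else 0) * [ U? (x ∷ v) ]?)
      pointwise : ∀ x → f x ≡ n₀ * [ x ≟ᵏ 0ᵏ ]? + n₁ * [ x ≟ᵏ 1ᵏ ]?
      pointwise x with x ≟ᵏ 0ᵏ | x ≟ᵏ 1ᵏ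
      ... | yes refl | yes 0≡1 = contradiction 0≡1 (0≢1 F)
      ... | yes refl | no _    = sym (trans (cong₂ _+_ (ℕ.*-identityʳ n₀) (ℕ.*-zeroʳ n₁)) (ℕ.+-identityʳ n₀))
      ... | no _     | yes refl = trans (∑-cong (allVecs F m) λ v → ℕ.*-identityˡ [ U? (1ᵏ ∷ v) ]?)
                                    (sym (cong₂ _+_ (ℕ.*-zeroʳ n₀) (ℕ.*-identityʳ n₁)))
      ... | no _     | no _    = trans (∑-zero (allVecs F m)) (sym (cong₂ _+_ (ℕ.*-zeroʳ n₀) (ℕ.*-zeroʳ n₁)))

  module _ (p : ℕ) .{{_ : NonZero p}} (p∣q : p ∣ q) where
    open Congruence p

    p∣count : ∀ {m} {U : V m → Set} (U? : ∀ v → Dec (U v)) → Closed U →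
      (∃ λ v → v ≢ 0ᵛ × U v) → p ∣ ∣ U? ∣
    p∣count {zero}  U? cl ([] , v≢0 , _) = contradiction refl v≢0
    p∣count {suc m} U? cl (x ∷ v , xv≢0 , Uxv) with search (λ w → U? (1ᵏ ∷ w))
    ... | yes h = subst (p ∣_) (sym (count-suc-full U? cl h)) (∣m⇒∣m*n _ p∣q)
    ... | no none with x ≟ᵏ 0ᵏ
    ...   | no  x≢0  = contradiction (to-first-1 U? cl x≢0 v Uxv) none
    ...   | yes refl = subst (p ∣_) (sym (count-suc-thin U? cl none))
      (p∣count (λ w → U? (0ᵏ ∷ w)) (tail-closed cl) (v , xv≢0 ∘ cong (0ᵏ ∷_) , Uxv))

    -- The nonzero vectors are the nonzero multiples of the normalised ones, so `∣ U? ∣` is 1 plus q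
    -- - 1 times the point count; this is read modulo `p`. The induction needs no division: a fibre
    -- over 1 adds to the point count the vector count of the slice at 0, while the new vector count
    -- is divisible by `q`.
    normalisedCount+count : ∀ {m} {U : V m → Set} (U? : ∀ v → Dec (U v)) → Closed U →
      normalisedCount U? + ∣ U? ∣ ≈ 1
    normalisedCount+count {zero}  U? cl =
      cong (λ x → (x + 0) % p) ([]?-yes (U? []) (zero∈ cl))
    normalisedCount+count {suc m} U? cl with ih ← normalisedCount+count (λ w → U? (0ᵏ ∷ w)) (tail-closed cl)
      | search (λ w → U? (1ᵏ ∷ w))
    ... | yes h rewrite normalisedCount-suc U? cl | fibre-constant U? cl h 1ᵏ | count-suc-full U? cl h =
      +-≈ ih (∣⇒≈0 (∣m⇒∣m*n _ p∣q))
    ... | no none rewrite normalisedCount-suc U? cl | fibre-empty U? cl none 1ᵏ (0≢1 F ∘ sym)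
      | count-suc-thin U? cl none | ℕ.+-identityʳ (normalisedCount (λ v → U? (0ᵏ ∷ v))) = ih

    normalisedCount≈1 : ∀ {m} {U : V m → Set} (U? : ∀ v → Dec (U v)) → Closed U →
      (∃ λ v → v ≢ 0ᵛ × U v) → normalisedCount U? ≈ 1
    normalisedCount≈1 U? cl h = begin
      normalisedCount U? % p              ≡⟨ cong (_% p) (ℕ.+-identityʳ (normalisedCount U?)) ⟨
      (normalisedCount U? + 0) % p        ≡⟨ +-≈ {normalisedCount U?} refl (∣⇒≈0 (p∣count U? cl h)) ⟨
      (normalisedCount U? + ∣ U? ∣) % p   ≡⟨ normalisedCount+count U? cl ⟩
      1 % p                               ∎
      where open ≡-Reasoning

-- Products of affine forms on a punctured grid

module Jamison (F : FiniteField) where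
  open LinearAlgebra F

  -- Streams are power series over F, and a vector (u₀, u₁, …) acts on them as
  -- multiplication by the polynomial u₀ + u₁ t + ….
  Stream : Set
  Stream = ℕ → K

  infix 4 _≋_
  infixl 6 _⊞_
  infixr 7 _⊡_ _▷_

  _≋_ : Stream → Stream → Set
  f ≋ g = ∀ i → f i ≡ g i

  𝟎 : Stream
  𝟎 _ = 0ᵏ

  𝟏 : Stream
  𝟏 zero    = 1ᵏ
  𝟏 (suc _) = 0ᵏ

  _⊞_ : Stream → Stream → Stream
  (f ⊞ g) i = f i +ᵏ g i

  _⊡_ : K → Stream → Stream
  (a ⊡ f) i = a *ᵏ f i

  delay : Stream → Stream
  delay f zero    = 0ᵏ
  delay f (suc i) = f i

  _▷_ : ∀ {k} → V k → Stream → Stream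
  []      ▷ f = 𝟎
  (a ∷ u) ▷ f = a ⊡ f ⊞ delay (u ▷ f)

  delay-cong : ∀ {f g} → f ≋ g → delay f ≋ delay g
  delay-cong h zero    = refl
  delay-cong h (suc i) = h i

  +ᵏ-interchange : ∀ a b c d → (a +ᵏ b) +ᵏ (c +ᵏ d) ≡ (a +ᵏ c) +ᵏ (b +ᵏ d)
  +ᵏ-interchange a b c d = Vec.∷-injectiveˡ (⊕-interchange (a ∷ []) (b ∷ []) (c ∷ []) (d ∷ []))

  delay-⊞ : ∀ f g → delay (f ⊞ g) ≋ delay f ⊞ delay g
  delay-⊞ f g zero    = sym (+ᵏ-identityˡ 0ᵏ)
  delay-⊞ f g (suc i) = refl

  delay-⊡ : ∀ a f → delay (a ⊡ f) ≋ a ⊡ delay f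
  delay-⊡ a f zero    = sym (*ᵏ-zeroʳ a)
  delay-⊡ a f (suc i) = refl

  ▷-cong : ∀ {k} (u : V k) {f g} → f ≋ g → u ▷ f ≋ u ▷ g
  ▷-cong []      h i = refl
  ▷-cong (a ∷ u) h i = cong₂ _+ᵏ_ (cong (a *ᵏ_) (h i)) (delay-cong (▷-cong u h) i)

  ▷-𝟎 : ∀ {k} (u : V k) → u ▷ 𝟎 ≋ 𝟎
  ▷-𝟎 []      i = refl
  ▷-𝟎 (a ∷ u) i = trans (cong₂ _+ᵏ_ (*ᵏ-zeroʳ a) (trans (delay-cong (▷-𝟎 u) i) (delay-𝟎 i))) (+ᵏ-identityˡ 0ᵏ)
    where
    delay-𝟎 : delay 𝟎 ≋ 𝟎
    delay-𝟎 zero    = refl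
    delay-𝟎 (suc i) = refl

  ▷-distrib-⊞ : ∀ {k} (u : V k) f g → u ▷ (f ⊞ g) ≋ u ▷ f ⊞ u ▷ g
  ▷-distrib-⊞ []      f g i = sym (+ᵏ-identityˡ 0ᵏ)
  ▷-distrib-⊞ (a ∷ u) f g i = trans
    (cong₂ _+ᵏ_ (*ᵏ-distribˡ a (f i) (g i))
                (trans (delay-cong (▷-distrib-⊞ u f g) i) (delay-⊞ (u ▷ f) (u ▷ g) i)))
    (+ᵏ-interchange _ _ _ _)

  ▷-⊡ : ∀ {k} (u : V k) a f → u ▷ (a ⊡ f) ≋ a ⊡ (u ▷ f)
  ▷-⊡ []      a f i = sym (*ᵏ-zeroʳ a)
  ▷-⊡ (b ∷ u) a f i = trans
    (cong₂ _+ᵏ_ (trans (sym (*ᵏ-assoc b a (f i))) (trans (cong (_*ᵏ f i) (*ᵏ-comm b a)) (*ᵏ-assoc a b (f i))))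
                (trans (delay-cong (▷-⊡ u a f) i) (delay-⊡ a (u ▷ f) i)))
    (sym (*ᵏ-distribˡ a _ _))

  ▷-delay : ∀ {k} (u : V k) f → u ▷ delay f ≋ delay (u ▷ f)
  ▷-delay []      f zero    = refl
  ▷-delay []      f (suc i) = refl
  ▷-delay (a ∷ u) f zero    = trans (+ᵏ-identityʳ _) (*ᵏ-zeroʳ a)
  ▷-delay (a ∷ u) f (suc i) = cong (a *ᵏ f i +ᵏ_) (▷-delay u f i)

  ▷-comm : ∀ {k l} (u : V k) (v : V l) f → u ▷ v ▷ f ≋ v ▷ u ▷ f
  ▷-comm []      v f i = sym (▷-𝟎 v i)
  ▷-comm (a ∷ u) v f i = sym (trans (▷-distrib-⊞ v (a ⊡ f) (delay (u ▷ f)) i)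
    (cong₂ _+ᵏ_ (▷-⊡ v a f i)
      (trans (▷-delay v (u ▷ f) i) (delay-cong (λ j → sym (▷-comm u v f j)) i))))

  ⊕-▷ : ∀ {k} (u v : V k) f → (u ⊕ v) ▷ f ≋ u ▷ f ⊞ v ▷ f
  ⊕-▷ []      []      f i = sym (+ᵏ-identityˡ 0ᵏ)
  ⊕-▷ (a ∷ u) (b ∷ v) f i = trans
    (cong₂ _+ᵏ_ (*ᵏ-distribʳ (f i) a b) (trans (delay-cong (⊕-▷ u v f) i) (delay-⊞ (u ▷ f) (v ▷ f) i)))
    (+ᵏ-interchange _ _ _ _)

  ·-▷ : ∀ {k} a (u : V k) f → (a · u) ▷ f ≋ a ⊡ (u ▷ f)
  ·-▷ a []      f i = sym (*ᵏ-zeroʳ a)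
  ·-▷ a (b ∷ u) f i = trans
    (cong₂ _+ᵏ_ (*ᵏ-assoc a b (f i)) (trans (delay-cong (·-▷ a u f) i) (delay-⊡ a (u ▷ f) i)))
    (sym (*ᵏ-distribˡ a _ _))

  0ᵛ-▷ : ∀ {k} f → 0ᵛ {k} ▷ f ≋ 𝟎
  0ᵛ-▷ {k} f i = trans (cong (λ u → (u ▷ f) i) (sym (·-zeroˡ (0ᵛ {k}))))
    (trans (·-▷ 0ᵏ (0ᵛ {k}) f i) (*ᵏ-zeroˡ _))

  -- Multiplication by a polynomial never lowers an exponent, so coefficient `i` of the product
  -- involves only coefficients of `f` up to `i`.
  ▷-local : ∀ {k} (u : V k) f i → (∀ j → j ≤ i → f j ≡ 0ᵏ) → (u ▷ f) i ≡ 0ᵏ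
  ▷-local []      f i       h = refl
  ▷-local (a ∷ u) f zero    h = trans (+ᵏ-identityʳ _) (trans (cong (a *ᵏ_) (h 0 z≤n)) (*ᵏ-zeroʳ a))
  ▷-local (a ∷ u) f (suc i) h = trans
    (cong₂ _+ᵏ_ (trans (cong (a *ᵏ_) (h (suc i) ℕ.≤-refl)) (*ᵏ-zeroʳ a))
                (▷-local u f i (λ j j≤i → h j (ℕ.m≤n⇒m≤1+n j≤i))))
    (+ᵏ-identityˡ 0ᵏ)

  -- Absence of zero divisors: factors t of `u` are stripped until its constant term is invertible,
  -- and then the coefficients of `f` are solved for one after another.
  ▷-cancel-0 : ∀ {k} (u : V k) {f} → u ≢ 0ᵛ → u ▷ f ≋ 𝟎 → f ≋ 𝟎
  ▷-cancel-0 []      u≢0 h = contradiction refl u≢0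
  ▷-cancel-0 (a ∷ u) {f} u≢0 h with a ≟ᵏ 0ᵏ
  ... | yes refl = ▷-cancel-0 u (u≢0 ∘ cong (0ᵏ ∷_)) (λ i →
    trans (sym (trans (cong (_+ᵏ (u ▷ f) i) (*ᵏ-zeroˡ (f (suc i)))) (+ᵏ-identityˡ _))) (h (suc i)))
  ... | no a≢0 = λ i → upTo i i ℕ.≤-refl
    where
    at : ∀ i → delay (u ▷ f) i ≡ 0ᵏ → f i ≡ 0ᵏ
    at i eq = *ᵏ-cancel-0 a≢0 (trans (sym (trans (cong (a *ᵏ f i +ᵏ_) eq) (+ᵏ-identityʳ _))) (h i))
    -- Strong induction on the index, with `i` as a bound: at `suc j` the part coming from `u`
    -- involves only coefficients up to `j`.
    upTo : ∀ i j → j ≤ i → f j ≡ 0ᵏ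
    upTo i       zero    _          = at 0 refl
    upTo (suc i) (suc j) (s≤s j≤i) = at (suc j) (▷-local u f j (λ l l≤j → upTo i l (ℕ.≤-trans l≤j j≤i)))

  -- Polynomial maps of two vectors and their difference quotients

  module _ {k : ℕ} where

    -- In each variable the linear part is a scalar, so an increment `δ` changes the value by a
    -- constant multiple of the polynomial `δ`.
    record Affine (ℓ : V k → V k → V k) : Set where
      field
        slopeˡ slopeʳ : K
        stepˡ : ∀ u δ v → ℓ (u ⊕ δ) v ≡ ℓ u v ⊕ slopeˡ · δ
        stepʳ : ∀ u v δ → ℓ u (v ⊕ δ) ≡ ℓ u v ⊕ slopeʳ · δ

    open Affine

    Affine-flip : ∀ {ℓ} → Affine ℓ → Affine (λ u v → ℓ v u)
    Affine-flip a = record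
      { slopeˡ = slopeʳ a ; slopeʳ = slopeˡ a
      ; stepˡ = λ u δ v → stepʳ a v u δ ; stepʳ = λ u v δ → stepˡ a v δ u }

    Affine-fixˡ : ∀ {ℓ} → Affine ℓ → ∀ w → Affine (λ _ v → ℓ w v)
    Affine-fixˡ a w = record
      { slopeˡ = 0ᵏ ; slopeʳ = slopeʳ a
      ; stepˡ = λ u δ v → sym (trans (cong (_ ⊕_) (·-zeroˡ δ)) (⊕-identityʳ _))
      ; stepʳ = λ _ → stepʳ a w }

    -- Polynomial expressions in affine forms, with stream coefficients and total degree below the
    -- index. The bound is strict so that index 0 forces the function to vanish.
    data Degree< : ℕ → (V k → V k → Stream) → Set where
      zeroᵈ  : ∀ {d} → Degree< d (λ _ _ → 𝟎)
      constᵈ : ∀ {d} f → Degree< (suc d) (λ _ _ → f)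
      sumᵈ   : ∀ {d g h} → Degree< d g → Degree< d h → Degree< d (λ u v → g u v ⊞ h u v)
      scaleᵈ : ∀ {d g} a → Degree< d g → Degree< d (λ u v → a ⊡ g u v)
      mulᵈ   : ∀ {d g ℓ} → Affine ℓ → Degree< d g → Degree< (suc d) (λ u v → ℓ u v ▷ g u v)

    Degree<-flip : ∀ {d g} → Degree< d g → Degree< d (λ u v → g v u)
    Degree<-flip zeroᵈ        = zeroᵈ
    Degree<-flip (constᵈ f)   = constᵈ f
    Degree<-flip (sumᵈ g h)   = sumᵈ (Degree<-flip g) (Degree<-flip h)
    Degree<-flip (scaleᵈ a g) = scaleᵈ a (Degree<-flip g)
    Degree<-flip (mulᵈ ℓ g)   = mulᵈ (Affine-flip ℓ) (Degree<-flip g)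

    Degree<0 : ∀ {g} → Degree< 0 g → ∀ u v → g u v ≋ 𝟎
    Degree<0 zeroᵈ        u v i = refl
    Degree<0 (sumᵈ g h)   u v i = trans (cong₂ _+ᵏ_ (Degree<0 g u v i) (Degree<0 h u v i)) (+ᵏ-identityˡ 0ᵏ)
    Degree<0 (scaleᵈ a g) u v i = trans (cong (a *ᵏ_) (Degree<0 g u v i)) (*ᵏ-zeroʳ a)

    -- The quotient is a function of the new point `w ⊕ δ`, not of `δ`, so it can be a polynomial
    -- map that is divided again.
    IsQuotient : V k → (g g′ : V k → V k → Stream) → Set
    IsQuotient w g g′ = ∀ δ v → g (w ⊕ δ) v ≋ g w v ⊞ δ ▷ g′ (w ⊕ δ) v

    -- Product rule: as ℓ(w + δ) = ℓ(w) + xδ, the increment of ℓg is δ(ℓ(w)g′ + xg) with g and g′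
    -- taken at w + δ; here `δ` is moved past ℓ(w) by commutativity.
    difference-quotient : ∀ {d g} w → Degree< (suc d) g → ∃ λ g′ → Degree< d g′ × IsQuotient w g g′
    difference-quotient w zeroᵈ = (λ _ _ → 𝟎) , zeroᵈ , λ δ v i → sym (trans (+ᵏ-identityˡ _) (▷-𝟎 δ i))
    difference-quotient w (constᵈ f) = (λ _ _ → 𝟎) , zeroᵈ ,
      λ δ v i → sym (trans (cong (f i +ᵏ_) (▷-𝟎 δ i)) (+ᵏ-identityʳ _))
    difference-quotient w (sumᵈ dg dh)
      with g′ , dg′ , qg ← difference-quotient w dg | h′ , dh′ , qh ← difference-quotient w dh =
      _ , sumᵈ dg′ dh′ , λ δ v i → trans (cong₂ _+ᵏ_ (qg δ v i) (qh δ v i))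
        (trans (+ᵏ-interchange _ _ _ _) (cong (_ +ᵏ_) (sym (▷-distrib-⊞ δ (g′ _ v) (h′ _ v) i))))
    difference-quotient w (scaleᵈ a dg) with g′ , dg′ , qg ← difference-quotient w dg =
      _ , scaleᵈ a dg′ , λ δ v i → trans (cong (a *ᵏ_) (qg δ v i))
        (trans (*ᵏ-distribˡ a _ _) (cong (_ +ᵏ_) (sym (▷-⊡ δ a (g′ _ v) i))))
    -- With bound 1 on the product, the cofactor has bound 0, so everything vanishes and 0 is a
    -- quotient.
    difference-quotient {zero} w (mulᵈ {g = g} {ℓ} aff dg) = (λ _ _ → 𝟎) , zeroᵈ , λ δ v i →
      trans (vanish (w ⊕ δ) v i) (sym (trans (cong₂ _+ᵏ_ (vanish w v i) (▷-𝟎 δ i)) (+ᵏ-identityˡ 0ᵏ)))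
      where
      vanish : ∀ u v → ℓ u v ▷ g u v ≋ 𝟎
      vanish u v i = trans (▷-cong (ℓ u v) (Degree<0 dg u v) i) (▷-𝟎 (ℓ u v) i)
    difference-quotient {suc d} w (mulᵈ {g = g} {ℓ} aff dg) with g′ , dg′ , qg ← difference-quotient w dg =
      _ , sumᵈ (mulᵈ (Affine-fixˡ aff w) dg′) (scaleᵈ x dg) , quotient
      where
      open ≡-Reasoning
      x = slopeˡ aff
      quotient : ∀ δ v → ℓ (w ⊕ δ) v ▷ g (w ⊕ δ) v ≋
        ℓ w v ▷ g w v ⊞ δ ▷ (ℓ w v ▷ g′ (w ⊕ δ) v ⊞ x ⊡ g (w ⊕ δ) v)
      quotient δ v i = begin
        (ℓ (w ⊕ δ) v ▷ G) i
          ≡⟨ cong (λ z → (z ▷ G) i) (stepˡ aff w δ v) ⟩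
        ((ℓ w v ⊕ x · δ) ▷ G) i
          ≡⟨ ⊕-▷ (ℓ w v) (x · δ) G i ⟩
        (ℓ w v ▷ G) i +ᵏ ((x · δ) ▷ G) i
          ≡⟨ cong₂ _+ᵏ_ (trans (▷-cong (ℓ w v) (qg δ v) i) (▷-distrib-⊞ (ℓ w v) (g w v) (δ ▷ G′) i))
                        (trans (·-▷ x δ G i) (sym (▷-⊡ δ x G i))) ⟩
        ((ℓ w v ▷ g w v) i +ᵏ (ℓ w v ▷ δ ▷ G′) i) +ᵏ (δ ▷ x ⊡ G) i
          ≡⟨ +ᵏ-assoc _ _ _ ⟩
        (ℓ w v ▷ g w v) i +ᵏ ((ℓ w v ▷ δ ▷ G′) i +ᵏ (δ ▷ x ⊡ G) i)
          ≡⟨ cong (λ z → (ℓ w v ▷ g w v) i +ᵏ (z +ᵏ (δ ▷ x ⊡ G) i)) (▷-comm (ℓ w v) δ G′ i) ⟩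
        (ℓ w v ▷ g w v) i +ᵏ ((δ ▷ ℓ w v ▷ G′) i +ᵏ (δ ▷ x ⊡ G) i)
          ≡⟨ cong ((ℓ w v ▷ g w v) i +ᵏ_) (▷-distrib-⊞ δ (ℓ w v ▷ G′) (x ⊡ G) i) ⟨
        (ℓ w v ▷ g w v) i +ᵏ (δ ▷ (ℓ w v ▷ G′ ⊞ x ⊡ G)) i
          ∎
        where
        G  = g (w ⊕ δ) v
        G′ = g′ (w ⊕ δ) v

    VanishesOffOrigin : (us vs : List (V k)) → (V k → V k → Stream) → Set
    VanishesOffOrigin us vs g = ∀ u v → u ≡ 0ᵛ ⊎ u ∈ us → v ≡ 0ᵛ ⊎ v ∈ vs → ¬ (u ≡ 0ᵛ × v ≡ 0ᵛ) → g u v ≋ 𝟎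

    quotient-off : ∀ {w g g′} → IsQuotient w g g′ → ∀ u v → g u v ≋ g w v ⊞ (u ⊕ ⊖ w) ▷ g′ u v
    quotient-off {w} {g} {g′} qg u v i =
      subst (λ z → g z v i ≡ g w v i +ᵏ ((u ⊕ ⊖ w) ▷ g′ z v) i) (⊕-⊖-⊕ u w) (qg (u ⊕ ⊖ w) v i)

    -- As g w vanishes on the grid, g agrees there with (u − w) times its difference quotient at w, so the
    -- quotient inherits the hypotheses on the grid without w.
    divide-out : ∀ {d} us {vs g} → Unique us → All (_≢ 0ᵛ) us → Degree< (length us + d) g →
      VanishesOffOrigin us vs g → ¬ (g 0ᵛ 0ᵛ ≋ 𝟎) →
      ∃ λ g′ → Degree< d g′ × VanishesOffOrigin [] vs g′ × ¬ (g′ 0ᵛ 0ᵛ ≋ 𝟎)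
    divide-out []       _        _          dg van g00 = _ , dg , van , g00
    divide-out (w ∷ us) {vs} {g} (w∉ ∷ uniq) (w≢0 ∷ us≢0) dg van g00
      with g′ , dg′ , qg ← difference-quotient w dg = divide-out us uniq us≢0 dg′ van′ g′00
      where
      van-w : ∀ v → v ≡ 0ᵛ ⊎ v ∈ vs → g w v ≋ 𝟎
      van-w v v∈ = van w v (inj₂ (here refl)) v∈ (w≢0 ∘ proj₁)
      van′ : VanishesOffOrigin us vs g′
      van′ u v u∈ v∈ off = ▷-cancel-0 (u ⊕ ⊖ w) (u≢w u∈ ∘ ⊕⊖-zero u w) (λ i → begin
        ((u ⊕ ⊖ w) ▷ g′ u v) i               ≡⟨ +ᵏ-identityˡ _ ⟨
        0ᵏ +ᵏ ((u ⊕ ⊖ w) ▷ g′ u v) i         ≡⟨ cong (_+ᵏ _) (van-w v v∈ i) ⟨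
        g w v i +ᵏ ((u ⊕ ⊖ w) ▷ g′ u v) i    ≡⟨ quotient-off {g′ = g′} qg u v i ⟨
        g u v i                              ≡⟨ van u v (map₂ there u∈) v∈ off i ⟩
        0ᵏ                                   ∎)
        where
        open ≡-Reasoning
        u≢w : u ≡ 0ᵛ ⊎ u ∈ us → u ≢ w
        u≢w (inj₁ u≡0) u≡w = w≢0 (trans (sym u≡w) u≡0)
        u≢w (inj₂ u∈)  u≡w = All.lookup w∉ u∈ (sym u≡w)
      g′00 : ¬ (g′ 0ᵛ 0ᵛ ≋ 𝟎)
      g′00 h = g00 λ i → trans (quotient-off {g′ = g′} qg 0ᵛ 0ᵛ i) (trans
        (cong₂ _+ᵏ_ (van-w 0ᵛ (inj₁ refl) i) (trans (▷-cong (0ᵛ ⊕ ⊖ w) h i) (▷-𝟎 (0ᵛ ⊕ ⊖ w) i)))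
        (+ᵏ-identityˡ 0ᵏ))

    -- Otherwise dividing out all of `us` in the first variable and, after exchanging the variables,
    -- all of `vs` in the second leaves a function with degree bound 0 that does not vanish at the
    -- origin.
    punctured-grid : ∀ us vs {g} → Unique us → Unique vs → All (_≢ 0ᵛ) us → All (_≢ 0ᵛ) vs →
      Degree< (length us + (length vs + 0)) g →
      VanishesOffOrigin us vs g → g 0ᵛ 0ᵛ ≋ 𝟎
    punctured-grid us vs {g} uu uv us≢0 vs≢0 dg van i with g 0ᵛ 0ᵛ i ≟ᵏ 0ᵏ
    ... | yes eq = eq
    ... | no neq
      with g₁ , dg₁ , van₁ , g₁00 ← divide-out us uu us≢0 dg van (λ h → neq (h i))
      with g₂ , dg₂ , van₂ , g₂00 ← divide-out vs {[]} uv vs≢0 (Degree<-flip dg₁)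
             (λ u v u∈ v∈ off → van₁ v u v∈ u∈ (off ∘ λ (a , b) → b , a)) g₁00
      = contradiction (Degree<0 dg₂ 0ᵛ 0ᵛ) g₂00

    -- Zero sets of affine forms covering all but the origin

    product : List (V k → V k → V k) → V k → V k → Stream
    product []       u v = 𝟏
    product (ℓ ∷ ℓs) u v = ℓ u v ▷ product ℓs u v

    -- The empty product 1 accounts for the `suc`; the surplus `d` can be chosen to meet a
    -- prescribed bound.
    product-degree : ∀ {ℓs d} → All Affine ℓs → Degree< (length ℓs + suc d) (product ℓs)
    product-degree []       = constᵈ 𝟏
    product-degree (a ∷ as) = mulᵈ a (product-degree as)

    -- Nonzero factors cancel one by one, and the empty product 1 is not zero.
    product-≋𝟎 : ∀ ℓs {u v} → product ℓs u v ≋ 𝟎 → Any (λ ℓ → ℓ u v ≡ 0ᵛ) ℓs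
    product-≋𝟎 []       h = contradiction (sym (h 0)) (0≢1 F)
    product-≋𝟎 (ℓ ∷ ℓs) {u} {v} h with ℓ u v ≟ᵛ 0ᵛ
    ... | yes eq = here eq
    ... | no neq = there (product-≋𝟎 ℓs (▷-cancel-0 (ℓ u v) neq h))

    product-root : ∀ {ℓs u v} → Any (λ ℓ → ℓ u v ≡ 0ᵛ) ℓs → product ℓs u v ≋ 𝟎
    product-root {ℓ ∷ ℓs} {u} {v} (here eq) i =
      trans (cong (λ z → (z ▷ product ℓs u v) i) eq) (0ᵛ-▷ {k} (product ℓs u v) i)
    product-root {ℓ ∷ ℓs} {u} {v} (there a) i = trans (▷-cong (ℓ u v) (product-root a) i) (▷-𝟎 (ℓ u v) i)

    -- The product of the forms has degree less than 2(q^k - 1) and vanishes off the origin, so by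
    -- `punctured-grid`, with all nonzero vectors on both sides, it vanishes at the origin as well.
    covering-bound : ∀ ℓs → All Affine ℓs → suc (suc (suc (length ℓs))) ≤ 2 * q ^ k →
      (∀ u v → ¬ (u ≡ 0ᵛ × v ≡ 0ᵛ) → Any (λ ℓ → ℓ u v ≡ 0ᵛ) ℓs) →
      Any (λ ℓ → ℓ 0ᵛ 0ᵛ ≡ 0ᵛ) ℓs
    covering-bound ℓs affine bound cover
      with us , p ← ∈⇒↭ (∈-allVecs (0ᵛ {k}))
      with 0∉ ∷ uniq ← Permₛ.Unique-resp-↭ (setoid (V k)) (↭⇒↭ₛ p) (allVecs-unique k) =
      product-≋𝟎 ℓs (punctured-grid us us uniq uniq us≢0 us≢0
        (subst (λ d → Degree< d (product ℓs)) degree (product-degree {d = slack} affine))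
        (λ u v _ _ off → product-root (cover u v off)))
      where
      us≢0 : All (_≢ 0ᵛ) us
      us≢0 = All.map (λ 0≢u u≡0 → 0≢u (sym u≡0)) 0∉
      length-us : suc (length us) ≡ q ^ k
      length-us = trans (sym (↭-length p)) (length-allVecs k)
      bound′ : suc (length ℓs) ≤ length us + (length us + 0)
      bound′ = ℕ.≤-pred (ℕ.≤-pred (subst (suc (suc (suc (length ℓs))) ≤_)
        (trans (cong (2 *_) (sym length-us)) (ℕ.*-suc 2 (length us))) bound))
      -- `punctured-grid` asks for the exact bound 2(q^k - 1), so the difference is filled up.
      slack = length us + (length us + 0) ∸ suc (length ℓs)
      degree : length ℓs + suc slack ≡ length us + (length us + 0)
      degree = trans (ℕ.+-suc (length ℓs) slack) (ℕ.m+[n∸m]≡n bound′)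

-- Intersections of subspaces with codewords

module Geometry (F : FiniteField) where
  open LinearAlgebra F
  open Closed

  infix 4 _∈ˢ_ _∈ˢ?_
  _∈ˢ_ : ∀ {n d} → V (suc n) → Subspace F n d → Set
  _∈ˢ_ = _∈S_ F

  _∈ˢ?_ : ∀ {n d} (P : V (suc n)) (S : Subspace F n d) → Dec (P ∈ˢ S)
  _∈ˢ?_ = _∈S?_ F

  lincomb-⊕ : ∀ {m d} (λs μs : V d) (B : Vec (V m) d) →
    lincomb F (λs ⊕ μs) B ≡ lincomb F λs B ⊕ lincomb F μs B
  lincomb-⊕ []       []       []      = sym (⊕-identityˡ 0ᵛ)
  lincomb-⊕ (a ∷ λs) (b ∷ μs) (v ∷ B) = trans
    (cong₂ _⊕_ (·-distrib-+ᵏ a b v) (lincomb-⊕ λs μs B)) (⊕-interchange _ _ _ _)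

  lincomb-· : ∀ {m d} a (λs : V d) (B : Vec (V m) d) → lincomb F (a · λs) B ≡ a · lincomb F λs B
  lincomb-· a []       []      = sym (·-zeroʳ a)
  lincomb-· a (b ∷ λs) (v ∷ B) = trans
    (cong₂ _⊕_ (·-assoc a b v) (lincomb-· a λs B)) (sym (·-distrib-⊕ a _ _))

  lincomb-0 : ∀ {m d} (B : Vec (V m) d) → lincomb F 0ᵛ B ≡ 0ᵛ
  lincomb-0 B = trans (cong (λ z → lincomb F z B) (sym (·-zeroˡ 0ᵛ)))
    (trans (lincomb-· 0ᵏ 0ᵛ B) (·-zeroˡ _))

  module _ {n d} (S : Subspace F n d) where

    combination : V (suc d) → V (suc n)
    combination λs = lincomb F λs (proj₁ S)

    ∈ˢ⁺ : ∀ {P} λs → combination λs ≡ P → P ∈ˢ S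
    ∈ˢ⁺ λs eq = lose (∈-allVecs λs) eq

    ∈ˢ⁻ : ∀ {P} → P ∈ˢ S → ∃ λ λs → combination λs ≡ P
    ∈ˢ⁻ P∈ = let λs , _ , eq = find P∈ in λs , eq

    subspace-closed : Closed (_∈ˢ S)
    subspace-closed = record
      { zero∈ = ∈ˢ⁺ 0ᵛ (lincomb-0 (proj₁ S))
      ; ⊕∈ = λ hu hv → let λs , eq = ∈ˢ⁻ hu ; μs , eq′ = ∈ˢ⁻ hv in
          ∈ˢ⁺ (λs ⊕ μs) (trans (lincomb-⊕ λs μs (proj₁ S)) (cong₂ _⊕_ eq eq′))
      ; ·∈ = λ a h → let λs , eq = ∈ˢ⁻ h in
          ∈ˢ⁺ (a · λs) (trans (lincomb-· a λs (proj₁ S)) (cong (a ·_) eq))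
      }

    combination-difference : ∀ λs μs → combination λs ⊕ ⊖ combination μs ≡ combination (λs ⊕ ⊖ μs)
    combination-difference λs μs = sym (trans (lincomb-⊕ λs (⊖ μs) (proj₁ S))
      (cong (combination λs ⊕_) (lincomb-· (-ᵏ 1ᵏ) μs (proj₁ S))))

    combination-injective : ∀ λs μs → combination λs ⊕ ⊖ combination μs ≡ 0ᵛ → λs ≡ μs
    combination-injective λs μs eq =
      ⊕⊖-zero λs μs (proj₂ S _ (trans (sym (combination-difference λs μs)) eq))

  ∩-closed : ∀ {m} {U W : V m → Set} → Closed U → Closed W → Closed (λ v → U v × W v)
  ∩-closed cu cw = record
    { zero∈ = zero∈ cu , zero∈ cw
    ; ⊕∈ = λ (a , b) (a′ , b′) → ⊕∈ cu a a′ , ⊕∈ cw b b′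
    ; ·∈ = λ x (a , b) → ·∈ cu x a , ·∈ cw x b }

  ⊕-≡⇒⊖-≡ : ∀ {m} (a b c d : V m) → a ⊕ b ≡ c ⊕ d → a ⊕ ⊖ c ≡ d ⊕ ⊖ b
  ⊕-≡⇒⊖-≡ a b c d eq = begin
    a ⊕ ⊖ c                   ≡⟨ ⊕-cancel-inverse (⊖-inverseʳ b) (a ⊕ ⊖ c) ⟨
    ((a ⊕ ⊖ c) ⊕ b) ⊕ ⊖ b     ≡⟨ cong (_⊕ ⊖ b) lemma ⟩
    d ⊕ ⊖ b                   ∎
    where
    open ≡-Reasoning
    lemma : (a ⊕ ⊖ c) ⊕ b ≡ d
    lemma = begin
      (a ⊕ ⊖ c) ⊕ b   ≡⟨ ⊕-assoc a (⊖ c) b ⟩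
      a ⊕ (⊖ c ⊕ b)   ≡⟨ cong (a ⊕_) (⊕-comm (⊖ c) b) ⟩
      a ⊕ (b ⊕ ⊖ c)   ≡⟨ ⊕-assoc a b (⊖ c) ⟨
      (a ⊕ b) ⊕ ⊖ c   ≡⟨ cong (_⊕ ⊖ c) (trans eq (⊕-comm c d)) ⟩
      (d ⊕ c) ⊕ ⊖ c   ≡⟨ ⊕-cancel-inverse (⊖-inverseʳ c) d ⟩
      d               ∎

  -- Dimension formula by counting: if only 0 were common, addition would map the q^(d+k+2) pairs
  -- injectively into F^(n+1), which has q^(d+k+1) vectors.
  subspaces-meet : ∀ {n d k} → n ≡ d + k → (S : Subspace F n d) (T : Subspace F n k) →
    ∃ λ v → v ≢ 0ᵛ × (v ∈ˢ S × v ∈ˢ T)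
  subspaces-meet {n} {d} {k} n≡d+k S T
    with search (λ v → ¬? (v ≟ᵛ 0ᵛ) ×-dec ((v ∈ˢ? S) ×-dec (v ∈ˢ? T)))
  ... | yes h = h
  ... | no none = contradiction tooMany (ℕ.<⇒≱ (begin-strict
      q ^ suc n               ≡⟨ cong (λ m → q ^ suc m) n≡d+k ⟩
      q ^ suc (d + k)         <⟨ ^-monoʳ (ℕ.≤-reflexive (cong suc (sym (ℕ.+-suc d k)))) ⟩
      q ^ (suc d + suc k)     ≡⟨ ℕ.^-distribˡ-+-* q (suc d) (suc k) ⟩
      q ^ suc d * q ^ suc k   ∎))
    where
    open ℕ.≤-Reasoning
    ^-monoʳ : ∀ {a b} → a < b → q ^ a < q ^ b
    ^-monoʳ = ℕ.^-monoʳ-< q order>1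

    trivial : ∀ {v} → v ∈ˢ S → v ∈ˢ T → v ≡ 0ᵛ
    trivial {v} v∈S v∈T with v ≟ᵛ 0ᵛ
    ... | yes eq = eq
    ... | no neq = contradiction (v , neq , v∈S , v∈T) none

    pairs = cartesianProduct (allVecs F (suc d)) (allVecs F (suc k))

    add : V (suc d) × V (suc k) → V (suc n)
    add (λs , μs) = combination S λs ⊕ combination T μs

    add-injective : ∀ {x y} → add x ≡ add y → x ≡ y
    add-injective {λs , μs} {λs′ , μs′} eq = cong₂ _,_
      (combination-injective S λs λs′ diff≡0)
      (sym (combination-injective T μs′ μs (trans (sym diff) diff≡0)))
      where
      diff : combination S λs ⊕ ⊖ combination S λs′ ≡ combination T μs′ ⊕ ⊖ combination T μs
      diff = ⊕-≡⇒⊖-≡ _ _ _ _ eq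
      -- Equal sums make a difference of vectors of `S` equal to one of vectors of `T`, hence a
      -- vector of both.
      diff≡0 : combination S λs ⊕ ⊖ combination S λs′ ≡ 0ᵛ
      diff≡0 = trivial (∈ˢ⁺ S (λs ⊕ ⊖ λs′) (sym (combination-difference S λs λs′)))
        (∈ˢ⁺ T (μs′ ⊕ ⊖ μs) (sym (trans diff (combination-difference T μs′ μs))))

    tooMany : q ^ suc d * q ^ suc k ≤ q ^ suc n
    tooMany = begin
      q ^ suc d * q ^ suc k
        ≡⟨ cong₂ _*_ (length-allVecs (suc d)) (length-allVecs (suc k)) ⟨
      length (allVecs F (suc d)) * length (allVecs F (suc k))
        ≡⟨ length-cartesianProduct (allVecs F (suc d)) _ ⟨
      length pairs
        ≡⟨ List.length-map add pairs ⟨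
      length (map add pairs)
        ≤⟨ length-⊆ (Unique.map⁺ add-injective
                       (Unique.cartesianProduct⁺ (allVecs-unique (suc d)) (allVecs-unique (suc k))))
             (λ v _ → ∈-allVecs v) ⟩
      length (allVecs F (suc n))
        ≡⟨ length-allVecs (suc n) ⟩
      q ^ suc n ∎

  -- Scalar products of codewords with subspaces

  module Code (p : ℕ) .{{_ : NonZero p}} (p∣q : p ∣ q) where
    open Congruence p

    scalar-≡-∑ : ∀ {n d} (c : Word F n) (S : Subspace F n d) → scalar F p c S ≡
      ∑ (allVecs F (suc n)) (λ P → (if isNormalised F P then 1 else 0) * ([ P ∈ˢ? S ]? * c P)) % p
    scalar-≡-∑ {n} c S = cong (_% p) (trans
      (∑-filterᵇ (λ P → ⌊ P ∈ˢ? S ⌋) (points F n) c)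
      (∑-filterᵇ (isNormalised F) (allVecs F (suc n)) _))

    -- Each generator meets `S` in a nonzero subspace, which has 1 mod `p` points, so it contributes
    -- just its coefficient. The value does not depend on `S`.
    scalar-codeword : ∀ {n d k} → n ≡ d + k → (c : Word F n) (code : InCode F p k n c) (S : Subspace F n d) →
      scalar F p c S ≡ ∑ (proj₁ code) proj₂ % p
    scalar-codeword {n} n≡d+k c (gens , c≡) S = trans (scalar-≡-∑ c S) (begin
      ∑ vs (λ P → N P * ([ P ∈ˢ? S ]? * c P)) % p
        ≡⟨ ∑-≈ vs reduce ⟩
      ∑ vs (λ P → ∑ gens (λ g → proj₂ g * M g P)) % p
        ≡⟨ cong (_% p) (∑-swap vs gens _) ⟩
      ∑ gens (λ g → ∑ vs (λ P → proj₂ g * M g P)) % p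
        ≡⟨ cong (_% p) (∑-cong gens λ g → ∑-*ˡ vs (proj₂ g) (M g)) ⟩
      ∑ gens (λ g → proj₂ g * ∑ vs (M g)) % p
        ≡⟨ ∑-≈ gens (λ (T , a) → *-≈ {a} refl (normalisedCount≈1 p p∣q
             (λ v → (v ∈ˢ? S) ×-dec (v ∈ˢ? T)) (∩-closed (subspace-closed S) (subspace-closed T))
             (subspaces-meet n≡d+k S T))) ⟩
      ∑ gens (λ g → proj₂ g * 1) % p
        ≡⟨ cong (_% p) (∑-cong gens λ g → ℕ.*-identityʳ (proj₂ g)) ⟩
      ∑ gens proj₂ % p ∎)
      where
      open ≡-Reasoning
      vs = allVecs F (suc n)
      N : V (suc n) → ℕ
      N P = if isNormalised F P then 1 else 0
      M : _ → V (suc n) → ℕ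
      M g P = N P * [ (P ∈ˢ? S) ×-dec (P ∈ˢ? proj₁ g) ]?
      word : V (suc n) → ℕ
      word P = ∑ gens (λ g → proj₂ g * incidence F (proj₁ g) P)
      pull : ∀ P → N P * ([ P ∈ˢ? S ]? * word P) ≡ ∑ gens (λ g → proj₂ g * M g P)
      pull P = begin
        N P * ([ P ∈ˢ? S ]? * word P)
          ≡⟨ cong (N P *_) (∑-*ˡ gens [ P ∈ˢ? S ]? _) ⟨
        N P * ∑ gens (λ g → [ P ∈ˢ? S ]? * (proj₂ g * incidence F (proj₁ g) P))
          ≡⟨ ∑-*ˡ gens (N P) _ ⟨
        ∑ gens (λ g → N P * ([ P ∈ˢ? S ]? * (proj₂ g * incidence F (proj₁ g) P)))
          ≡⟨ ∑-cong gens (λ g → trans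
               (solve 4 (λ n s a t → n :* (s :* (a :* t)) := a :* (n :* (s :* t))) refl
                 (N P) [ P ∈ˢ? S ]? (proj₂ g) (incidence F (proj₁ g) P))
               (cong (λ z → proj₂ g * (N P * z)) ([]?-× (P ∈ˢ? S) (P ∈ˢ? proj₁ g)))) ⟩
        ∑ gens (λ g → proj₂ g * M g P) ∎
        where open +-*-Solver
      reduce : ∀ P → N P * ([ P ∈ˢ? S ]? * c P) ≈ ∑ gens (λ g → proj₂ g * M g P)
      reduce P = trans step (cong (_% p) (pull P))
        where
        step : N P * ([ P ∈ˢ? S ]? * c P) ≈ N P * ([ P ∈ˢ? S ]? * word P)
        -- `c` is known to be a combination of incidence vectors only at points; elsewhere the
        -- factor `N P` is 0.
        step with isNormalised F P in eq
        ... | false = refl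
        ... | true  = *-≈ {1} refl (*-≈ {[ P ∈ˢ? S ]?} refl (trans (cong (_% p) (c≡ P eq)) (%-≈ (word P))))

-- Projections and graphs

module Coordinates (F : FiniteField) where
  open LinearAlgebra F
  open Geometry F

  -- The images of the standard basis vectors, which supply the basis that `Subspace` requires.
  columns : ∀ {m d} → (V d → V m) → Vec (V m) d
  columns {d = zero}  L = []
  columns {d = suc d} L = L (1ᵏ ∷ 0ᵛ) ∷ columns (λ v → L (0ᵏ ∷ v))

  lincomb-columns : ∀ {m d} (L : V d → V m) →
    (∀ u v → L (u ⊕ v) ≡ L u ⊕ L v) → (∀ a v → L (a · v) ≡ a · L v) →
    ∀ λs → lincomb F λs (columns L) ≡ L λs
  lincomb-columns {d = zero}  L L-⊕ L-· [] = trans (sym (·-zeroˡ (L []))) (sym (L-· 0ᵏ []))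
  lincomb-columns {d = suc d} L L-⊕ L-· (a ∷ λs) = begin
    a · L (1ᵏ ∷ 0ᵛ) ⊕ lincomb F λs (columns (λ v → L (0ᵏ ∷ v)))
      ≡⟨ cong₂ _⊕_ (sym (L-· a (1ᵏ ∷ 0ᵛ))) (lincomb-columns (λ v → L (0ᵏ ∷ v))
           (λ u v → trans (cong (λ z → L (z ∷ (u ⊕ v))) (sym (+ᵏ-identityˡ 0ᵏ))) (L-⊕ _ _))
           (λ b v → trans (cong (λ z → L (z ∷ b · v)) (sym (*ᵏ-zeroʳ b))) (L-· b _)) λs) ⟩
    L (a · (1ᵏ ∷ 0ᵛ)) ⊕ L (0ᵏ ∷ λs)
      ≡⟨ L-⊕ _ _ ⟨
    L (a · (1ᵏ ∷ 0ᵛ) ⊕ (0ᵏ ∷ λs))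
      ≡⟨ cong L (cong₂ _∷_ (trans (+ᵏ-identityʳ _) (*ᵏ-identityʳ a))
           (trans (cong (_⊕ λs) (·-zeroʳ a)) (⊕-identityˡ λs))) ⟩
    L (a ∷ λs) ∎
    where open ≡-Reasoning

  -- A linear isomorphism of F^N with F^a ⊕ F^b. The vectors with `back` equal to 0 form an
  -- a-dimensional subspace, and `back` is the projection from it.
  record Splitting (N a b : ℕ) : Set where
    field
      front      : V N → V a
      back       : V N → V b
      glue       : V a → V b → V N
      glue-split : ∀ v → glue (front v) (back v) ≡ v
      front-glue : ∀ x y → front (glue x y) ≡ x
      back-glue  : ∀ x y → back (glue x y) ≡ y
      glue-⊕     : ∀ x x′ y y′ → glue (x ⊕ x′) (y ⊕ y′) ≡ glue x y ⊕ glue x′ y′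
      glue-·     : ∀ c x y → glue (c · x) (c · y) ≡ c · glue x y

    glue-0 : glue 0ᵛ 0ᵛ ≡ 0ᵛ
    glue-0 = trans (cong₂ glue (sym (·-zeroˡ 0ᵛ)) (sym (·-zeroˡ 0ᵛ))) (trans (glue-· 0ᵏ 0ᵛ 0ᵛ) (·-zeroˡ _))

    front-0 : front 0ᵛ ≡ 0ᵛ
    front-0 = trans (cong front (sym glue-0)) (front-glue 0ᵛ 0ᵛ)

    back-0 : back 0ᵛ ≡ 0ᵛ
    back-0 = trans (cong back (sym glue-0)) (back-glue 0ᵛ 0ᵛ)

  -- A splitting with one-dimensional first part: `rest` is the projection from the point spanned by
  -- `glue 1ᵏ 0ᵛ`.
  record Peeling (m : ℕ) : Set where
    field
      coord      : V (suc m) → K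
      rest       : V (suc m) → V m
      glue       : K → V m → V (suc m)
      glue-split : ∀ v → glue (coord v) (rest v) ≡ v
      coord-glue : ∀ a v → coord (glue a v) ≡ a
      rest-glue  : ∀ a v → rest (glue a v) ≡ v
      glue-⊕     : ∀ a b u v → glue (a +ᵏ b) (u ⊕ v) ≡ glue a u ⊕ glue b v
      glue-·     : ∀ c a v → glue (c *ᵏ a) (c · v) ≡ c · glue a v

  open Splitting
  open Peeling using (coord; rest)

  -- The coordinates of a vector relative to 1 ∷ x and the standard basis vectors but the first.
  shear : ∀ {m} → V m → Peeling m
  shear x = record
    { coord = head
    ; rest = λ v → tail v ⊕ (-ᵏ head v) · x
    ; glue = λ a v → a ∷ (v ⊕ a · x)
    ; glue-split = λ where (y ∷ ys) → cong (y ∷_) (⊕-cancel-inverse (·-inverseˡ y x) ys)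
    ; coord-glue = λ _ _ → refl
    ; rest-glue = λ a v → ⊕-cancel-inverse (·-inverseʳ a x) v
    ; glue-⊕ = λ a b u v → cong (_ ∷_) (trans (cong ((u ⊕ v) ⊕_) (·-distrib-+ᵏ a b x)) (⊕-interchange u v _ _))
    ; glue-· = λ c a v → cong (_ ∷_) (trans (cong (c · v ⊕_) (·-assoc c a x)) (sym (·-distrib-⊕ c v _)))
    }

  -- For centres with first coordinate 0, which is carried along unchanged in `rest`.
  peel-second : ∀ {m} → Peeling m → Peeling (suc m)
  peel-second P = record
    { coord = λ v → P.coord (tail v)
    ; rest = λ v → head v ∷ P.rest (tail v)
    ; glue = λ a v → head v ∷ P.glue a (tail v)
    ; glue-split = λ where (y ∷ ys) → cong (y ∷_) (P.glue-split ys)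
    ; coord-glue = λ a v → P.coord-glue a (tail v)
    ; rest-glue = λ where a (y ∷ ys) → cong (y ∷_) (P.rest-glue a ys)
    ; glue-⊕ = λ where a b (y ∷ u) (z ∷ v) → cong (_ ∷_) (P.glue-⊕ a b u v)
    ; glue-· = λ where c a (y ∷ v) → cong (_ ∷_) (P.glue-· c a v)
    }
    where module P = Peeling P

  -- Composition of projections: the new centre is spanned by the point of `P` and a lift of the
  -- centre of `S`.
  _∷ˢ_ : ∀ {N a b} → Peeling N → Splitting N a b → Splitting (suc N) (suc a) b
  P ∷ˢ S = record
    { front = λ v → P.coord v ∷ S.front (P.rest v)
    ; back = λ v → S.back (P.rest v)
    ; glue = λ x y → P.glue (head x) (S.glue (tail x) y)
    ; glue-split = λ v → trans (cong (P.glue (P.coord v)) (S.glue-split (P.rest v))) (P.glue-split v)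
    ; front-glue = λ where (a ∷ x) y → cong₂ _∷_ (P.coord-glue a _)
                             (trans (cong S.front (P.rest-glue a _)) (S.front-glue x y))
    ; back-glue = λ x y → trans (cong S.back (P.rest-glue (head x) _)) (S.back-glue (tail x) y)
    ; glue-⊕ = λ where (a ∷ x) (b ∷ x′) y y′ → trans (cong (P.glue _) (S.glue-⊕ x x′ y y′)) (P.glue-⊕ a b _ _)
    ; glue-· = λ where c (a ∷ x) y → trans (cong (P.glue _) (S.glue-· c x y)) (P.glue-· c a _)
    }
    where
    module P = Peeling P
    module S = Splitting S

  trivialSplitting : ∀ {N} → Splitting N 0 N
  trivialSplitting = record
    { front = λ _ → []
    ; back = id
    ; glue = λ _ y → y
    ; glue-split = λ _ → refl
    ; front-glue = λ where [] _ → refl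
    ; back-glue = λ _ _ → refl
    ; glue-⊕ = λ _ _ _ _ → refl
    ; glue-· = λ _ _ _ → refl
    }

  -- `rest (shear x) y` is 0 just when `y` is a multiple of `1ᵏ ∷ x`; a nonzero `y` then has nonzero
  -- first coordinate and determines `x`.
  shear-hits : ∀ {m} (y : V (suc m)) → y ≢ 0ᵛ →
    ∑ (allVecs F m) (λ x → [ rest (shear x) y ≟ᵛ 0ᵛ ]?) ≤ 1
  shear-hits {m} (y₀ ∷ y) y≢0 = ∑-atMostOne (λ x → rest (shear x) (y₀ ∷ y) ≟ᵛ 0ᵛ) (allVecs-unique m) same
    where
    open ≡-Reasoning
    same : ∀ x x′ → y ⊕ (-ᵏ y₀) · x ≡ 0ᵛ → y ⊕ (-ᵏ y₀) · x′ ≡ 0ᵛ → x ≡ x′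
    same x x′ h h′ with y₀ ≟ᵏ 0ᵏ
    ... | yes refl = contradiction (cong (0ᵏ ∷_) (begin
      y                 ≡⟨ ⊕-cancel-inverse (·-inverseˡ 0ᵏ x) y ⟨
      _ ⊕ 0ᵏ · x        ≡⟨ cong₂ _⊕_ h (·-zeroˡ x) ⟩
      0ᵛ ⊕ 0ᵛ           ≡⟨ ⊕-identityˡ 0ᵛ ⟩
      0ᵛ                ∎)) y≢0
    ... | no y₀≢0 = ⊕⊖-zero x x′ (·-cancelˡ-0 (-ᵏ-nonzero y₀≢0) (begin
      (-ᵏ y₀) · (x ⊕ ⊖ x′)                ≡⟨ ·-distrib-⊕ _ x (⊖ x′) ⟩
      (-ᵏ y₀) · x ⊕ (-ᵏ y₀) · ⊖ x′        ≡⟨ cong ((-ᵏ y₀) · x ⊕_) ·-⊖ ⟩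
      (-ᵏ y₀) · x ⊕ ⊖ ((-ᵏ y₀) · x′)      ≡⟨ ⊕-≡⇒⊖-≡ _ y _ y
                                               (trans (⊕-comm _ y) (trans h (sym (trans (⊕-comm _ y) h′)))) ⟩
      y ⊕ ⊖ y                             ≡⟨ ⊖-inverseʳ y ⟩
      0ᵛ                                  ∎))
      where
      ·-⊖ : (-ᵏ y₀) · ⊖ x′ ≡ ⊖ ((-ᵏ y₀) · x′)
      ·-⊖ = trans (sym (·-assoc (-ᵏ y₀) (-ᵏ 1ᵏ) x′))
        (trans (cong (_· x′) (*ᵏ-comm _ _)) (·-assoc (-ᵏ 1ᵏ) (-ᵏ y₀) x′))

  -- As `q` is at least 2, every projection but the last has enough centres for the averaging to
  -- leave no hit at all.
  doubling : ∀ j k → 2 * q ^ k ≤ q ^ (suc j + k) * 1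
  doubling j k = begin
    2 * q ^ k             ≤⟨ ℕ.*-monoˡ-≤ (q ^ k) order>1 ⟩
    q ^ suc k             ≤⟨ ℕ.^-monoʳ-≤ q {{>-nonZero (ℕ.<-trans z<s order>1)}} (s≤s (ℕ.m≤n+m k j)) ⟩
    q ^ (suc j + k)       ≡⟨ ℕ.*-identityʳ _ ⟨
    q ^ (suc j + k) * 1   ∎
    where open ℕ.≤-Reasoning

  module _ {X : Set} where

    -- Double counting of pairs of a centre `x` and an entry `z` sent to 0: each `z` is lost for at
    -- most one `x`, so some `x` loses fewer than `t` entries.
    choose-shear : ∀ {m} t (zs : List X) (f : X → V (suc m)) → (∀ z → z ∈ zs → f z ≢ 0ᵛ) →
      length zs < q ^ m * t → ∃ λ x → ∑ zs (λ z → [ rest (shear x) (f z) ≟ᵛ 0ᵛ ]?) < t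
    choose-shear {m} t zs f f≢0 few = ∑-<⇒∃ t (allVecs F m) _ (begin-strict
      ∑ (allVecs F m) (λ x → ∑ zs (λ z → [ rest (shear x) (f z) ≟ᵛ 0ᵛ ]?))
        ≡⟨ ∑-swap (allVecs F m) zs _ ⟩
      ∑ zs (λ z → ∑ (allVecs F m) (λ x → [ rest (shear x) (f z) ≟ᵛ 0ᵛ ]?))
        ≤⟨ ∑-≤-length zs (λ z z∈ → shear-hits (f z) (f≢0 z z∈)) ⟩
      length zs                 <⟨ few ⟩
      q ^ m * t                 ≡⟨ cong (_* t) (length-allVecs m) ⟨
      length (allVecs F m) * t  ∎)
      where open ℕ.≤-Reasoning

    -- Projecting from one point after another, one keeps all the f z nonzero as long as the target has
    -- more points than there are z; in the last step the bound only prevents two of them from vanishing.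
    nearly-avoiding-splitting : ∀ j {k} (zs : List X) (f : X → V (suc j + k)) → (∀ z → z ∈ zs → f z ≢ 0ᵛ) →
      length zs < 2 * q ^ k →
      Σ (Splitting (suc j + k) (suc j) k) λ s → ∑ zs (λ z → [ back s (f z) ≟ᵛ 0ᵛ ]?) < 2
    nearly-avoiding-splitting zero {k} zs f f≢0 few
      with x , hits ← choose-shear 2 zs f f≢0 (subst (length zs <_) (ℕ.*-comm 2 (q ^ k)) few) =
      shear x ∷ˢ trivialSplitting , hits
    nearly-avoiding-splitting (suc j) {k} zs f f≢0 few
      with x , hits ← choose-shear 1 zs f f≢0 (ℕ.<-≤-trans few (doubling j k))
      with s , hits′ ← nearly-avoiding-splitting j zs (rest (shear x) ∘ f)
             (λ z z∈ → []?≡0⇒¬ _ (∑-≡0⁻ zs (ℕ.n<1⇒n≡0 hits) z z∈)) few =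
      shear x ∷ˢ s , hits′

  -- Projection from a given point

  zero-not-normalised : ∀ m → isNormalised F (0ᵛ {m}) ≡ false
  zero-not-normalised zero = refl
  zero-not-normalised (suc m) with 0ᵏ ≟ᵏ 0ᵏ
  ... | yes _   = zero-not-normalised m
  ... | no  0≢0 = contradiction refl 0≢0

  -- A shear at the first nonzero coordinate, which is 1, once `peel-second` has skipped the leading
  -- zeros.
  peeling-at-point : ∀ {m} (R : V (suc m)) → isNormalised F R ≡ true →
    Σ (Peeling m) λ P → coord P R ≡ 1ᵏ × rest P R ≡ 0ᵛ
  peeling-at-point (x ∷ R) norm with x ≟ᵏ 0ᵏ
  peeling-at-point {zero}  (x ∷ []) () | yes refl
  peeling-at-point {suc m} (x ∷ R)  norm | yes refl with P , c , r ← peeling-at-point R norm =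
    peel-second P , c , cong (0ᵏ ∷_) r
  peeling-at-point (x ∷ R) norm | no _ with x ≟ᵏ 1ᵏ
  ... | yes refl = shear R , refl , trans (cong (_⊕ (-ᵏ 1ᵏ) · R) (sym (·-identityˡ R))) (·-inverseʳ 1ᵏ R)
  peeling-at-point (x ∷ R) () | no _ | no _

  -- The leading 1 of `R` becomes `a`, which must be 1, since 0 would make the multiple zero.
  normalised-multiple : ∀ {m} a (R : V m) → isNormalised F R ≡ true → isNormalised F (a · R) ≡ true → a · R ≡ R
  normalised-multiple {suc m} a (x ∷ R) nR naR with x ≟ᵏ 0ᵏ
  ... | yes refl with a *ᵏ 0ᵏ ≟ᵏ 0ᵏ
  ...   | yes eq = cong₂ _∷_ eq (normalised-multiple a R nR naR)
  ...   | no neq = contradiction (*ᵏ-zeroʳ a) neq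
  normalised-multiple {suc m} a (x ∷ R) nR naR | no _ with x ≟ᵏ 1ᵏ
  normalised-multiple {suc m} a (x ∷ R) () naR | no _ | no _
  ... | yes refl with a *ᵏ 1ᵏ ≟ᵏ 0ᵏ | a *ᵏ 1ᵏ ≟ᵏ 1ᵏ
  normalised-multiple {suc m} a (x ∷ R) nR () | no _ | yes refl | no _ | no _
  ...   | no _   | yes eq = trans (cong (_· (1ᵏ ∷ R)) (trans (sym (*ᵏ-identityʳ a)) eq)) (·-identityˡ _)
  ...   | yes eq | _ with () ← trans (sym naR) (trans
            (cong (λ b → isNormalised F (b · R)) (trans (sym (*ᵏ-identityʳ a)) eq))
            (trans (cong (isNormalised F) (·-zeroˡ R)) (zero-not-normalised m)))

  -- A vector projected to 0 from `R` is a multiple of `R`. Hence projecting from `R` keeps all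
  -- other points nonzero.
  peeling-separates : ∀ {m} (P : Peeling m) {R Q : V (suc m)} → coord P R ≡ 1ᵏ → rest P R ≡ 0ᵛ →
    isNormalised F R ≡ true → isNormalised F Q ≡ true → rest P Q ≡ 0ᵛ → Q ≡ R
  peeling-separates P {R} {Q} cR rR nR nQ rQ =
    trans Q≡aR (normalised-multiple a R nR (trans (cong (isNormalised F) (sym Q≡aR)) nQ))
    where
    open ≡-Reasoning
    module P = Peeling P
    a = coord P Q
    Q≡aR : Q ≡ a · R
    Q≡aR = begin
      Q                              ≡⟨ P.glue-split Q ⟨
      P.glue a (P.rest Q)            ≡⟨ cong₂ P.glue (sym (*ᵏ-identityʳ a)) (trans rQ (sym (·-zeroʳ a))) ⟩
      P.glue (a *ᵏ 1ᵏ) (a · 0ᵛ)      ≡⟨ P.glue-· a 1ᵏ 0ᵛ ⟩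
      a · P.glue 1ᵏ 0ᵛ               ≡⟨ cong (a ·_) (cong₂ P.glue cR rR) ⟨
      a · P.glue (P.coord R) (P.rest R) ≡⟨ cong (a ·_) (P.glue-split R) ⟩
      a · R                          ∎

  -- Graphs of linear maps as subspaces

  module Graph {n d k} (s : Splitting (suc n) (suc d) k) (A : V (suc d) → V k)
    (A-⊕ : ∀ x y → A (x ⊕ y) ≡ A x ⊕ A y) (A-· : ∀ a x → A (a · x) ≡ a · A x) where

    embed : V (suc d) → V (suc n)
    embed x = glue s x (A x)

    lincomb-embed : ∀ λs → lincomb F λs (columns embed) ≡ embed λs
    lincomb-embed = lincomb-columns embed
      (λ u v → trans (cong (glue s _) (A-⊕ u v)) (glue-⊕ s u v _ _))
      (λ a v → trans (cong (glue s _) (A-· a v)) (glue-· s a v _))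

    -- `front s` inverts the parametrisation, whence the columns are independent.
    graph : Subspace F n d
    graph = columns embed , λ λs eq → begin
      λs               ≡⟨ front-glue s λs (A λs) ⟨
      front s (embed λs) ≡⟨ cong (front s) (trans (sym (lincomb-embed λs)) eq) ⟩
      front s 0ᵛ       ≡⟨ front-0 s ⟩
      0ᵛ               ∎
      where open ≡-Reasoning

    ∈-graph⁺ : ∀ {P} → A (front s P) ≡ back s P → P ∈ˢ graph
    ∈-graph⁺ {P} eq = ∈ˢ⁺ graph (front s P)
      (trans (lincomb-embed _) (trans (cong (glue s _) eq) (glue-split s P)))

    ∈-graph⁻ : ∀ {P} → P ∈ˢ graph → A (front s P) ≡ back s P
    ∈-graph⁻ P∈ with λs , eq ← ∈ˢ⁻ graph P∈ with refl ← trans (sym (lincomb-embed λs)) eq =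
      trans (cong A (front-glue s λs _)) (sym (back-glue s λs _))

-- Tangent subspaces of the support

module Tangents (F : FiniteField) (p : ℕ) .{{_ : NonZero p}} where
  open LinearAlgebra F
  open Geometry F
  open Coordinates F
  open Jamison F using (Affine; covering-bound)
  open Congruence p
  open Splitting

  isNonzero : ∀ {n} → Word F n → V (suc n) → Bool
  isNonzero c P = ⌊ ¬? (c P ℕ.≟ 0) ⌋

  support : ∀ {n} → Word F n → List (V (suc n))
  support {n} c = filterᵇ (isNonzero c) (points F n)

  ∈-support⁺ : ∀ {n} (c : Word F n) {P} → supp F c P → P ∈ support c
  ∈-support⁺ c {P} (isPoint , cP≢0) = ∈-filterᵇ⁺ (isNonzero c)
    (∈-filterᵇ⁺ (isNormalised F) (∈-allVecs P) isPoint) nonzero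
    where
    nonzero : isNonzero c P ≡ true
    nonzero with c P ℕ.≟ 0
    ... | yes cP≡0 = contradiction cP≡0 cP≢0
    ... | no _     = refl

  ∈-support⁻ : ∀ {n} (c : Word F n) {P} → P ∈ support c → supp F c P
  ∈-support⁻ {n} c {P} P∈ with P∈points , nonzero ← ∈-filterᵇ⁻ (isNonzero c) {xs = points F n} P∈ =
    proj₂ (∈-filterᵇ⁻ (isNormalised F) {xs = allVecs F (suc n)} P∈points) , cP≢0 nonzero
    where
    cP≢0 : isNonzero c P ≡ true → c P ≢ 0
    cP≢0 eq with c P ℕ.≟ 0
    cP≢0 () | yes _
    ... | no cP≢0 = cP≢0

  support-unique : ∀ {n} (c : Word F n) → Unique (support c)
  support-unique {n} c = Unique.filter⁺ (T? ∘ isNonzero c)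
    (Unique.filter⁺ (T? ∘ isNormalised F) (allVecs-unique (suc n)))

  support-split : ∀ {n} (c : Word F n) {R} → supp F c R →
    ∃ λ Rs → support c ↭ R ∷ Rs × (∀ P → P ∈ Rs → supp F c P × P ≢ R)
  support-split {n} c {R} R-supp with Rs , support↭ ← ∈⇒↭ (∈-support⁺ c R-supp)
    with R∉ ∷ _ ← Permₛ.Unique-resp-↭ (setoid (V (suc n))) (↭⇒↭ₛ support↭) (support-unique c) =
    Rs , support↭ , λ P P∈ →
      ∈-support⁻ c (∈-resp-↭ (↭-sym support↭) (there P∈)) , λ P≡R → All.lookup R∉ P∈ (sym P≡R)

  scalar-support : ∀ {n d} (c : Word F n) (S : Subspace F n d) →
    scalar F p c S ≡ ∑ (support c) (λ P → [ P ∈ˢ? S ]? * c P) % p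
  scalar-support {n} c S = cong (_% p) (begin
    ∑ (filterᵇ (λ P → ⌊ P ∈ˢ? S ⌋) (points F n)) c  ≡⟨ ∑-filterᵇ _ (points F n) c ⟩
    ∑ (points F n) (λ P → [ P ∈ˢ? S ]? * c P)       ≡⟨ ∑-cong (points F n) pointwise ⟩
    ∑ (points F n) (λ P → (if isNonzero c P then 1 else 0) * ([ P ∈ˢ? S ]? * c P))
                                                    ≡⟨ ∑-filterᵇ (isNonzero c) (points F n) _ ⟨
    ∑ (support c) (λ P → [ P ∈ˢ? S ]? * c P)        ∎)
    where
    open ≡-Reasoning
    pointwise : ∀ P → [ P ∈ˢ? S ]? * c P ≡ (if isNonzero c P then 1 else 0) * ([ P ∈ˢ? S ]? * c P)
    pointwise P with c P ℕ.≟ 0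
    ... | yes cP≡0 = trans (cong ([ P ∈ˢ? S ]? *_) cP≡0) (ℕ.*-zeroʳ [ P ∈ˢ? S ]?)
    ... | no _     = sym (ℕ.*-identityˡ _)

  suppMeet-support : ∀ {n d} (c : Word F n) (S : Subspace F n d) →
    suppMeet F c S ≡ ∑ (support c) (λ P → [ P ∈ˢ? S ]?)
  suppMeet-support {n} c S = begin
    suppMeet F c S
      ≡⟨ length-filterᵇ (λ P → ⌊ P ∈ˢ? S ⌋ ∧ isNonzero c P) (points F n) ⟩
    ∑ (points F n) (λ P → if ⌊ P ∈ˢ? S ⌋ ∧ isNonzero c P then 1 else 0)
      ≡⟨ ∑-cong (points F n) (λ P → if-∧ ⌊ P ∈ˢ? S ⌋ (isNonzero c P)) ⟩
    ∑ (points F n) (λ P → (if isNonzero c P then 1 else 0) * [ P ∈ˢ? S ]?)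
      ≡⟨ ∑-filterᵇ (isNonzero c) (points F n) _ ⟨
    ∑ (support c) (λ P → [ P ∈ˢ? S ]?) ∎
    where
    open ≡-Reasoning
    if-∧ : ∀ a b → (if a ∧ b then 1 else 0) ≡ (if b then 1 else 0) * (if a then 1 else 0)
    if-∧ true  true  = refl
    if-∧ true  false = refl
    if-∧ false true  = refl
    if-∧ false false = refl

  -- Existence of tangent subspaces

  module _ {j k α : ℕ} (c : Word F (suc j + k))
    (c<p : ∀ P → IsPoint F (suc j + k) P → c P < p)
    (c-const : ∀ (S : Subspace F (suc j + k) (suc j)) → scalar F p c S ≡ α)
    (α≢0 : α ≢ 0) (light : weight F c < 2 * q ^ k) where

    private
      n = suc j + k

    -- S₀ is given by `back s` equal to 0 and contains `R` and `Q` but no other support point. The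
    -- form ξ is the first front coordinate and η the one at index `i` among the others, so ξ(R) =
    -- 1, η(R) = 0 and η(Q) is nonzero.
    module TwoSecant (s : Splitting (suc n) (2+ j) k) (R Q : V (suc n)) (Ps : List (V (suc n)))
      (support↭ : support c ↭ R ∷ Q ∷ Ps)
      (R-front : front s R ≡ 1ᵏ ∷ 0ᵛ) (R-back : back s R ≡ 0ᵛ)
      (Q-back : back s Q ≡ 0ᵛ) (i : Fin (suc j)) (Q-front : lookup (tail (front s Q)) i ≢ 0ᵏ)
      (off : ∀ P → P ∈ Ps → back s P ≢ 0ᵛ) where

      linear : V k → V k → V (2+ j) → V k
      linear u v x = head x · u ⊕ lookup (tail x) i · v

      linear-⊕ : ∀ u v x y → linear u v (x ⊕ y) ≡ linear u v x ⊕ linear u v y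
      linear-⊕ u v (a ∷ x) (b ∷ y) = trans
        (cong₂ _⊕_ (·-distrib-+ᵏ a b u)
          (trans (cong (_· v) (Vec.lookup-zipWith _+ᵏ_ i x y)) (·-distrib-+ᵏ (lookup x i) (lookup y i) v)))
        (⊕-interchange _ _ _ _)

      linear-· : ∀ u v a x → linear u v (a · x) ≡ a · linear u v x
      linear-· u v a (b ∷ x) = trans
        (cong₂ _⊕_ (·-assoc a b u)
          (trans (cong (_· v) (Vec.lookup-map i (a *ᵏ_) x)) (·-assoc a (lookup x i) v)))
        (sym (·-distrib-⊕ a _ _))

      module G u v = Graph s (linear u v) (linear-⊕ u v) (linear-· u v)

      -- Zero exactly when `P` lies on the graph for `u` and `v`.
      form : V (suc n) → V k → V k → V k
      form P u v = linear u v (front s P) ⊕ ⊖ back s P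

      form-affine : ∀ P → Affine (form P)
      form-affine P = record
        { slopeˡ = x ; slopeʳ = y
        ; stepˡ = λ u δ v → begin
            (x · (u ⊕ δ) ⊕ y · v) ⊕ e        ≡⟨ cong (λ z → (z ⊕ y · v) ⊕ e) (·-distrib-⊕ x u δ) ⟩
            ((x · u ⊕ x · δ) ⊕ y · v) ⊕ e    ≡⟨ cong (_⊕ e) (swapʳ (x · u) (x · δ) (y · v)) ⟩
            ((x · u ⊕ y · v) ⊕ x · δ) ⊕ e    ≡⟨ swapʳ _ (x · δ) e ⟩
            ((x · u ⊕ y · v) ⊕ e) ⊕ x · δ    ∎
        ; stepʳ = λ u v δ → begin
            (x · u ⊕ y · (v ⊕ δ)) ⊕ e        ≡⟨ cong (λ z → (x · u ⊕ z) ⊕ e) (·-distrib-⊕ y v δ) ⟩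
            (x · u ⊕ (y · v ⊕ y · δ)) ⊕ e    ≡⟨ cong (_⊕ e) (⊕-assoc (x · u) (y · v) (y · δ)) ⟨
            ((x · u ⊕ y · v) ⊕ y · δ) ⊕ e    ≡⟨ swapʳ _ (y · δ) e ⟩
            ((x · u ⊕ y · v) ⊕ e) ⊕ y · δ    ∎
        }
        where
        open ≡-Reasoning
        x = head (front s P)
        y = lookup (tail (front s P)) i
        e = ⊖ back s P
        swapʳ : ∀ {m} (a b c : V m) → (a ⊕ b) ⊕ c ≡ (a ⊕ c) ⊕ b
        swapʳ a b c = trans (⊕-assoc a b c) (trans (cong (a ⊕_) (⊕-comm b c)) (sym (⊕-assoc a c b)))

      linear-0 : ∀ x → linear 0ᵛ 0ᵛ x ≡ 0ᵛ
      linear-0 x = trans (cong₂ _⊕_ (·-zeroʳ _) (·-zeroʳ _)) (⊕-identityˡ 0ᵛ)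

      -- At the origin the form reduces to the negative of `back s P`.
      no-root-at-origin : ∀ P → P ∈ Ps → form P 0ᵛ 0ᵛ ≢ 0ᵛ
      no-root-at-origin P P∈ eq = off P P∈ (trans (sym (⊕⊖-zero _ _ eq)) (linear-0 (front s P)))

      -- Only `R` and `Q` can contribute to the scalar product; the final 0 is the sum over `Ps`.
      scalar-graph : ∀ u v → ¬ Any (λ P → form P u v ≡ 0ᵛ) Ps →
        ([ R ∈ˢ? G.graph u v ]? * c R + ([ Q ∈ˢ? G.graph u v ]? * c Q + 0)) % p ≡ α
      scalar-graph u v none = trans (cong (_% p) (sym (trans (∑-↭ g support↭)
          (cong (λ z → g R + (g Q + z)) (∑-≡0 Ps λ P P∈ → cong (_* c P) ([]?-no (P ∈ˢ? S) (P∉ P P∈)))))))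
        (trans (sym (scalar-support c S)) (c-const S))
        where
        S = G.graph u v
        g : V (suc n) → ℕ
        g P = [ P ∈ˢ? S ]? * c P
        P∉ : ∀ P → P ∈ Ps → ¬ (P ∈ˢ S)
        P∉ P P∈ P∈S = none (lose P∈
          (trans (cong (_⊕ ⊖ back s P) (G.∈-graph⁻ u v P∈S)) (⊖-inverseʳ (back s P))))

      R∈-graph⁻ : ∀ u v → R ∈ˢ G.graph u v → u ≡ 0ᵛ
      R∈-graph⁻ u v R∈ = begin
        u                       ≡⟨ trans (cong (1ᵏ · u ⊕_) (·-zeroˡ v)) (trans (⊕-identityʳ _) (·-identityˡ u)) ⟨
        1ᵏ · u ⊕ 0ᵏ · v         ≡⟨ cong (λ z → 1ᵏ · u ⊕ z · v) (Vec.lookup-replicate i 0ᵏ) ⟨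
        linear u v (1ᵏ ∷ 0ᵛ)    ≡⟨ cong (linear u v) R-front ⟨
        linear u v (front s R)  ≡⟨ G.∈-graph⁻ u v R∈ ⟩
        back s R                ≡⟨ R-back ⟩
        0ᵛ                      ∎
        where open ≡-Reasoning

      Q∈-graph⁻ : ∀ v → Q ∈ˢ G.graph 0ᵛ v → v ≡ 0ᵛ
      Q∈-graph⁻ v Q∈ = ·-cancelˡ-0 Q-front (begin
        lookup (tail (front s Q)) i · v   ≡⟨ trans (cong (_⊕ lookup (tail (front s Q)) i · v) (·-zeroʳ (head (front s Q))))
                                                   (⊕-identityˡ _) ⟨
        linear 0ᵛ v (front s Q)           ≡⟨ G.∈-graph⁻ 0ᵛ v Q∈ ⟩
        back s Q                          ≡⟨ Q-back ⟩
        0ᵛ                                ∎)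
        where open ≡-Reasoning

      R-supp : supp F c R
      R-supp = ∈-support⁻ c (∈-resp-↭ (↭-sym support↭) (here refl))

      Q-supp : supp F c Q
      Q-supp = ∈-support⁻ c (∈-resp-↭ (↭-sym support↭) (there (here refl)))

      α≡cR+cQ : (c R + c Q) % p ≡ α
      α≡cR+cQ = trans (cong (_% p) (sym (cong₂ _+_
          (trans (cong (_* c R) ([]?-yes (R ∈ˢ? G.graph 0ᵛ 0ᵛ) (G.∈-graph⁺ 0ᵛ 0ᵛ (trans (linear-0 (front s R)) (sym R-back)))))
            (ℕ.*-identityˡ (c R)))
          (trans (ℕ.+-identityʳ _) (trans
            (cong (_* c Q) ([]?-yes (Q ∈ˢ? G.graph 0ᵛ 0ᵛ) (G.∈-graph⁺ 0ᵛ 0ᵛ (trans (linear-0 (front s Q)) (sym Q-back)))))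
            (ℕ.*-identityˡ (c Q)))))))
        (scalar-graph 0ᵛ 0ᵛ λ any → let P , P∈ , eq = find any in no-root-at-origin P P∈ eq)

      value≢0 : ∀ {P} → supp F c P → ¬ (c P ≈ 0)
      value≢0 {P} (isPoint , cP≢0) h = cP≢0 (≈⇒≡ (c<p P isPoint) (ℕ.≤-<-trans z≤n (c<p P isPoint)) h)

      -- `R` and `Q` lie together on the graph only at the origin. If a graph misses `Ps` and one or
      -- both of them, comparing its scalar product α with c_R + c_Q gives c_Q = 0, c_R = 0 or α =
      -- 0, all excluded.
      cover : ∀ u v → ¬ (u ≡ 0ᵛ × v ≡ 0ᵛ) → Any (λ P → form P u v ≡ 0ᵛ) Ps
      cover u v off-origin with any? (λ P → form P u v ≟ᵛ 0ᵛ) Ps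
      ... | yes a = a
      ... | no none with h ← scalar-graph u v none | R ∈ˢ? G.graph u v | Q ∈ˢ? G.graph u v
      ... | yes R∈ | yes Q∈ = contradiction (u≡0 , v≡0) off-origin
        where
        u≡0 = R∈-graph⁻ u v R∈
        v≡0 = Q∈-graph⁻ v (subst (λ z → Q ∈ˢ G.graph z v) u≡0 Q∈)
      ... | yes _ | no _ = contradiction (sym (+-≈-cancelˡ (c R)
              (trans (trans (cong (λ z → (z + 0) % p) (sym (ℕ.*-identityˡ (c R)))) h) (sym α≡cR+cQ)))) (value≢0 Q-supp)
      ... | no _ | yes _ = contradiction (sym (+-≈-cancelˡ (c Q)
              (trans (trans (cong (_% p) (trans (ℕ.+-identityʳ (c Q))
                  (sym (trans (ℕ.+-identityʳ _) (ℕ.*-identityˡ (c Q)))))) h)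
                (trans (sym α≡cR+cQ) (cong (_% p) (ℕ.+-comm (c R) (c Q))))))) (value≢0 R-supp)
      ... | no _ | no _ = contradiction (trans (sym h) (m<n⇒m%n≡m (ℕ.≤-<-trans z≤n (c<p R (proj₁ R-supp))))) α≢0

      impossible : ⊥
      impossible = let P , P∈ , eq = find (Any.map⁻ root) in no-root-at-origin P P∈ eq
        where
        root : Any (λ ℓ → ℓ 0ᵛ 0ᵛ ≡ 0ᵛ) (map form Ps)
        root = covering-bound (map form Ps) (All.map⁺ (All.tabulate λ {P} _ → form-affine P))
          -- `Ps` lacks `R` and `Q`, so its length plus 3 is the weight plus 1, at most 2q^k.
          (subst₂ (λ a b → suc a ≤ b) (trans (↭-length support↭) (cong 2+ (sym (List.length-map form Ps)))) refl light)
          (λ u v off-origin → Any.map⁺ (cover u v off-origin))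

    -- The subspace S₀ found by successive projections, first from `R`, holds at most one further
    -- support point, and `TwoSecant` excludes that one.
    tangent : ∀ R → supp F c R → ∃ λ (S : Subspace F n (suc j)) → R ∈ˢ S × (∀ P → supp F c P → P ∈ˢ S → P ≡ R)
    tangent R R-supp
      with Rs , support↭ , others ← support-split c R-supp
      with peel , R-coord , R-rest ← peeling-at-point R (proj₁ R-supp) = result
      where
      module P = Peeling peel

      rest≢0 : ∀ P → P ∈ Rs → P.rest P ≢ 0ᵛ
      rest≢0 P P∈ eq = let P-supp , P≢R = others P P∈ in
        P≢R (peeling-separates peel R-coord R-rest (proj₁ R-supp) (proj₁ P-supp) eq)

      found = nearly-avoiding-splitting j Rs P.rest rest≢0
        (ℕ.<-trans (ℕ.≤-reflexive (sym (↭-length support↭))) light)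
      t = proj₁ found
      s = peel ∷ˢ t

      R-back : back s R ≡ 0ᵛ
      R-back = trans (cong (back t) R-rest) (back-0 t)

      -- The graph of the zero map is S₀, where `back s` is 0.
      module G = Graph s (λ _ → 0ᵛ) (λ _ _ → sym (⊕-identityˡ 0ᵛ)) (λ a _ → sym (·-zeroʳ a))

      result : ∃ λ (S : Subspace F n (suc j)) → R ∈ˢ S × (∀ P → supp F c P → P ∈ˢ S → P ≡ R)
      result with any? (λ P → back s P ≟ᵛ 0ᵛ) Rs
      ... | no none = G.graph , G.∈-graph⁺ (sym R-back) , only
        where
        only : ∀ P → supp F c P → P ∈ˢ G.graph → P ≡ R
        only P P-supp P∈S with ∈-resp-↭ support↭ (∈-support⁺ c P-supp)
        ... | here P≡R = P≡R
        ... | there P∈ = contradiction (lose P∈ (sym (G.∈-graph⁻ P∈S))) none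
      ... | yes some with Q , Q∈ , Q-back ← find some with Ps , Rs↭ ← ∈⇒↭ Q∈ =
        ⊥-elim (TwoSecant.impossible s R Q Ps
          (↭-trans support↭ (↭-prep R Rs↭))
          (cong₂ _∷_ R-coord (trans (cong (front t) R-rest) (front-0 t))) R-back Q-back
          (proj₁ coordinate) (proj₂ coordinate) off)
        where
        -- `Q` differs from `R`, so its projection from `R` is nonzero; as its `back` part vanishes,
        -- some front coordinate does not.
        coordinate : ∃ λ i → lookup (front t (P.rest Q)) i ≢ 0ᵏ
        coordinate = nonzero-coordinate (front t (P.rest Q)) λ eq → rest≢0 Q Q∈
          (trans (sym (glue-split t (P.rest Q))) (trans (cong₂ (glue t) eq Q-back) (glue-0 t)))
        -- `Q` uses up the one hit that the choice of `t` allows.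
        one-hit : 1 + ∑ Ps (λ P → [ back s P ≟ᵛ 0ᵛ ]?) < 2
        one-hit = subst (_< 2) (trans (∑-↭ _ Rs↭)
          (cong (_+ ∑ Ps (λ P → [ back s P ≟ᵛ 0ᵛ ]?)) ([]?-yes (back s Q ≟ᵛ 0ᵛ) Q-back))) (proj₂ found)
        off : ∀ P → P ∈ Ps → back s P ≢ 0ᵛ
        off P P∈ = []?≡0⇒¬ (back s P ≟ᵛ 0ᵛ) (∑-≡0⁻ Ps (ℕ.n<1⇒n≡0 (ℕ.≤-pred one-hit)) P P∈)

  -- Consequences of tangency: values, minimality and intersection numbers

  module _ (p-prime : Prime p) (p∣q : p ∣ q) where
    open Code p p∣q

    -- Equations for `n` and `d` replace the subtraction n ∸ k, so that matching on `refl` brings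
    -- the dimensions into the form `suc j + k` and `suc j`.
    conclusion : ∀ j k {n d} → n ≡ d + k → d ≡ suc j → (c : Word F n) → InCode F p k n c →
      weight F c < 2 * q ^ k → (∃ λ (S : Subspace F n d) → scalar F p c S ≢ 0) →
      (∀ S → ∃ λ P → supp F c P × _∈ˢ_ {n} {d} P S)
      × (∀ (B : PointSet F n) → (∀ P → B P → supp F c P) →
           (∀ (S : Subspace F n d) → ∃ λ P → B P × P ∈ˢ S) → ∀ P → supp F c P → B P)
      × (∃ λ (a : ℕ) → 0 < a × a < p × (∀ P → IsPoint F n P → c P ≡ 0 ⊎ c P ≡ a))
      × (∀ (S : Subspace F n d) → suppMeet F c S % p ≡ 1)
    conclusion j k {n} {d} refl refl c code light (S₀ , S₀≢0) =
      blocking , minimal , (α , ℕ.n≢0⇒n>0 α≢0 , α<p , two-valued) , meets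
      where
      α = ∑ (proj₁ code) proj₂ % p

      α<p : α < p
      α<p = m%n<n _ p

      c-const : ∀ (S : Subspace F n d) → scalar F p c S ≡ α
      c-const = scalar-codeword refl c code

      α≢0 : α ≢ 0
      α≢0 eq = S₀≢0 (trans (c-const S₀) eq)

      c<p : ∀ P → IsPoint F n P → c P < p
      c<p P isPoint = subst (_< p) (sym (proj₂ code P isPoint)) (m%n<n _ p)

      tangentAt = tangent c c<p c-const α≢0 light

      -- All terms of the scalar product α other than `c R` vanish.
      value-at-tangency : ∀ R → supp F c R → ∀ (S : Subspace F n d) → R ∈ˢ S →
        (∀ P → supp F c P → P ∈ˢ S → P ≡ R) → c R ≡ α
      value-at-tangency R R-supp S R∈S only with Rs , support↭ , others ← support-split c R-supp = begin
        c R                                           ≡⟨ m<n⇒m%n≡m (c<p R (proj₁ R-supp)) ⟨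
        c R % p                                       ≡⟨ cong (_% p) (ℕ.+-identityʳ (c R)) ⟨
        (c R + 0) % p                                 ≡⟨ cong₂ (λ x y → (x + y) % p)
          (trans (cong (_* c R) ([]?-yes (R ∈ˢ? S) R∈S)) (ℕ.*-identityˡ (c R)))
          (∑-≡0 Rs λ P P∈ → cong (_* c P) ([]?-no (P ∈ˢ? S)
            λ P∈S → proj₂ (others P P∈) (only P (proj₁ (others P P∈)) P∈S))) ⟨
        ∑ (R ∷ Rs) (λ P → [ P ∈ˢ? S ]? * c P) % p     ≡⟨ cong (_% p) (∑-↭ _ support↭) ⟨
        ∑ (support c) (λ P → [ P ∈ˢ? S ]? * c P) % p  ≡⟨ scalar-support c S ⟨
        scalar F p c S                                ≡⟨ c-const S ⟩
        α                                             ∎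
        where open ≡-Reasoning

      value : ∀ R → supp F c R → c R ≡ α
      value R R-supp = let S , R∈S , only = tangentAt R R-supp in value-at-tangency R R-supp S R∈S only

      blocking : ∀ (S : Subspace F n d) → ∃ λ P → supp F c P × P ∈ˢ S
      blocking S with any? (_∈ˢ? S) (support c)
      ... | yes a = let P , P∈ , P∈S = find a in P , ∈-support⁻ c P∈ , P∈S
      ... | no none = contradiction (trans (sym (c-const S)) (trans (scalar-support c S) (trans
              (cong (_% p) (∑-≡0 (support c) λ P P∈ → cong (_* c P) ([]?-no (P ∈ˢ? S) λ P∈S → none (lose P∈ P∈S))))
              (m<n⇒m%n≡m (ℕ.≤-<-trans z≤n α<p))))) α≢0

      -- A blocking subset must meet the tangent subspace at `R`, and can do so only in `R`.
      minimal : ∀ (B : PointSet F n) → (∀ P → B P → supp F c P) →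
        (∀ (S : Subspace F n d) → ∃ λ P → B P × P ∈ˢ S) → ∀ P → supp F c P → B P
      minimal B B⊆ B-blocks R R-supp =
        let S , _ , only = tangentAt R R-supp
            P , BP , P∈S = B-blocks S
        in subst B (only P (B⊆ P BP) P∈S) BP

      two-valued : ∀ P → IsPoint F n P → c P ≡ 0 ⊎ c P ≡ α
      two-valued P isPoint with c P ℕ.≟ 0
      ... | yes cP≡0 = inj₁ cP≡0
      ... | no cP≢0 = inj₂ (value P (isPoint , cP≢0))

      p>1 : 1 < p
      p>1 = nonTrivial⇒n>1 p {{prime⇒nonTrivial p-prime}}

      -- All nonzero coordinates at points equal α, so the scalar product is α times the number of
      -- support points in `S`.
      αN≈α : ∀ (S : Subspace F n d) → α * suppMeet F c S ≈ α
      αN≈α S = begin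
        α * suppMeet F c S % p                          ≡⟨ cong (λ z → α * z % p) (suppMeet-support c S) ⟩
        α * ∑ (support c) (λ P → [ P ∈ˢ? S ]?) % p      ≡⟨ cong (_% p) (∑-*ˡ (support c) α _) ⟨
        ∑ (support c) (λ P → α * [ P ∈ˢ? S ]?) % p      ≡⟨ cong (_% p) (∑-cong-∈ (support c) λ P P∈ →
                                                             trans (cong (_* [ P ∈ˢ? S ]?) (sym (value P (∈-support⁻ c P∈))))
                                                               (ℕ.*-comm (c P) _)) ⟩
        ∑ (support c) (λ P → [ P ∈ˢ? S ]? * c P) % p    ≡⟨ scalar-support c S ⟨
        scalar F p c S                                  ≡⟨ c-const S ⟩
        α                                               ≡⟨ m<n⇒m%n≡m α<p ⟨
        α % p                                           ∎
        where open ≡-Reasoning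

      α≉0 : ¬ (α ≈ 0)
      α≉0 h = α≢0 (≈⇒≡ α<p (ℕ.≤-<-trans z≤n α<p) h)

      -- For `suc N` the hypothesis says that `p` divides α times `N`, and `p` does not divide α.
      cancel-α : ∀ N → α * N ≈ α → N ≈ 1
      cancel-α zero    h = contradiction (trans (sym h) (cong (_% p) (ℕ.*-zeroʳ α))) α≉0
      cancel-α (suc N) h with euclidsLemma α N p-prime (≈0⇒∣ (+-≈-cancelˡ α
          (trans (cong (_% p) (sym (ℕ.*-suc α N))) (trans h (cong (_% p) (sym (ℕ.+-identityʳ α)))))))
      ... | inj₁ p∣α = contradiction (∣⇒≈0 p∣α) α≉0
      ... | inj₂ p∣N = +-≈ {1} refl (∣⇒≈0 p∣N)

      meets : ∀ (S : Subspace F n d) → suppMeet F c S % p ≡ 1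
      meets S = trans (cancel-α (suppMeet F c S) (αN≈α S)) (m<n⇒m%n≡m p>1)

theorem3p3 : (F : FiniteField) (p h n k : ℕ) .{{_ : NonZero p}} →
    Prime p → 1 ≤ h → order F ≡ p ^ h →
    2 ≤ n → 1 ≤ k → k ≤ n ∸ 1 →
    (c : Word F n) → InCode F p k n c →
    weight F c < 2 * order F ^ k →
    (∃ λ (S : Subspace F n (n ∸ k)) → scalar F p c S ≢ 0) →
    IsMinimalBlocking F n k (supp F c)
    × (∃ λ (a : ℕ) → 0 < a × a < p × (∀ P → IsPoint F n P → c P ≡ 0 ⊎ c P ≡ a))
    × (∀ (S : Subspace F n (n ∸ k)) → suppMeet F c S % p ≡ 1)
theorem3p3 F p (suc h) (suc n) k p-prime 1≤h q≡p^h 2≤n 1≤k k≤n c code light nonzero =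
  let blocking , minimal , two-valued , meets =
        -- The matched `h` is one below the exponent, so `p` divides the order. Likewise `n` is one
        -- below the dimension, and the subspaces have dimension `suc (n ∸ k)`.
        Tangents.conclusion F p p-prime (subst (p ∣_) (sym q≡p^h) (m∣m*n (p ^ h))) (n ∸ k) k
          (sym (ℕ.m∸n+n≡m (ℕ.m≤n⇒m≤1+n k≤n))) (ℕ.+-∸-assoc 1 k≤n) c code light nonzero
  in (((λ P → proj₁) , blocking) , λ B B⊆ (_ , B-blocks) → minimal B B⊆ B-blocks) , two-valued , meets
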